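{- For all typing contexts $\Gamma$, formulas $A$ and terms $u,v$: if $\Gamma\vdash_{\mathtt{NI}^p}u\rightsquigarrow_{\beta\eta\gamma}v:A$, then $\Gamma^*\vdash_{\mathtt{NI}^2_{at}}u^\sharp\simeq_{\beta\eta}v^\sharp:A^*$, where $(\cdot)^\sharp$ is the ESF-translation.
   Context: Notation for lists: for a finite (possibly empty) list $\mathcal A=\langle a_1,\dots,a_n\rangle$, $\langle A_a\rangle_{a\in\mathcal A}\supset B$ abbreviates $A_{a_1}\supset\dots\supset A_{a_n}\supset B$ (just $B$ if $\mathcal A$ is empty); $\lambda\langle x_a\rangle.t$ abbreviates $\lambda x_{a_1}\dots\lambda x_{a_n}.t$ and $t\langle u_a\rangle$ abbreviates $t\,u_{a_1}\cdots u_{a_n}$. Polynomial connectives. A polynomial connective $\dagger$ is given by finite (possibly empty) lists $\mathcal I,\mathcal J,\mathcal K$ and functions $f:\mathcal J\to\mathcal I$, $g:\mathcal J\to\mathcal K$; $g^{ -1}(k)$ is the sublist of the $j\in\mathcal J$ with $g(j)=k$. It forms a formula $\dagger\langle A_i\rangle_{i\in\mathcal I}$. Formulas. $\mathcal L^p$: $A::=X\mid A\supset B\mid\dagger\langle A_i\rangle$; $\mathcal L^2$: $A::=X\mid A\supset B\mid\forall X.A$. System $\mathtt{NI}^p$ over $\mathcal L^p$: terms $t::=x\mid\lambda x.t\mid tu\mid\iota_\dagger^k\langle t_j\rangle_{j\in g^{ -1}(k)}\mid\delta_\dagger(t,\langle\langle y_j\rangle_{j\in g^{ -1}(k)}.s_k\rangle_{k\in\mathcal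 K})$, with the usual rules for variables, $\lambda$ and application, and: for each $k\in\mathcal K$, from $\Gamma\vdash t_j:A_{f(j)}$ for all $j\in g^{ -1}(k)$ infer $\Gamma\vdash\iota_\dagger^k\langle t_j\rangle:\dagger\langle A_i\rangle$; from $\Gamma\vdash t:\dagger\langle A_i\rangle$ and $\Gamma,\langle y_j:A_{f(j)}\rangle_{j\in g^{ -1}(k)}\vdash s_k:C$ for all $k\in\mathcal K$ infer $\Gamma\vdash\delta_\dagger(t,\langle\langle y_j\rangle.s_k\rangle_k):C$. $\mathtt{NI}^2_{at}$ over $\mathcal L^2$: terms $x,\lambda x.t,tu,\Lambda X.t,tY$; System F typing ($\Lambda X.t:\forall X.A$ if $\Gamma\vdash t:A$, $X\notin FV(\Gamma)$) with type application restricted to variables: from $\Gamma\vdash t:\forall X.A$ infer $\Gamma\vdash tY:A\llbracket Y/X\rrbracket$, $Y$ a variable. Terms represent derivations; type information is regarded as part of the term, though not displayed, and the translation is defined by recursion on typing derivations. Contexts. A term context has a hole $[\ ]$; $\mathtt U[t]$ is capture-avoiding, $\mathtt U\{t\}$ variable-capturing, substitution for the hole. Elimination contexts of $\mathtt{NI}^p$: $\mathtt E::=[\ ]\mid\mathtt Eu\mid\delta_\dagger(\mathtt E,\langle\langle y_j\rangle.s_k\rangle)$. Conversions. In $\mathtt{NI}^p$, $\rightsquigarrow_{\beta\eta\gamma}$ is the relation on well-typed terms generated by reflexivity, transitivity, congruence and $(\lambda x.t)s\rightsquigarrow t\llbracket s/x\rrbracket$; $\delta_\dagger(\iota_\dagger^h\langle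 t_j\rangle,\langle\langle y_j\rangle.s_k\rangle_k)\rightsquigarrow s_h\llbracket\langle t_j\rangle/\langle y_j\rangle\rrbracket$; ($\supset\eta$) $\lambda x.tx\rightsquigarrow t$ ($x\notin FV(t)$); ($\dagger\eta$) $\delta_\dagger(t,\langle\langle y_j\rangle.\iota_\dagger^k\langle y_j\rangle\rangle_{k\in\mathcal K})\rightsquigarrow t$; ($\dagger\gamma$) $\mathtt E[\delta_\dagger(t,\langle\langle y_j\rangle.s_k\rangle_k)]\rightsquigarrow\delta_\dagger(t,\langle\langle y_j\rangle.\mathtt E[s_k]\rangle_k)$ for $\mathtt E$ an elimination context. In $\mathtt{NI}^2_{at}$, $\simeq_{\beta\eta}$ is the typed congruence (reflexive, symmetric, transitive) generated by $(\lambda x.t)s\simeq t\llbracket s/x\rrbracket$, $(\Lambda X.t)Y\simeq t\llbracket Y/X\rrbracket$, $\lambda x.tx\simeq t$ ($x\notin FV(t)$), $\Lambda X.tX\simeq t$ ($X\notin FV(t)$). Translation of formulas: $X^*=X$, $(A\supset B)^*=A^*\supset B^*$, $(\dagger\langle A_i\rangle)^*=\forall X.\langle\langle A_{f(j)}^*\rangle_{j\in g^{ -1}(k)}\supset X\rangle_{k\in\mathcal K}\supset X$ ($X$ not free in any $A_i$); $\Gamma^*$ translates all types in $\Gamma$. Weak expansion contexts. $\mathsf{at}(B)$ is the rightmost variable of $B\in\mathcal L^2$. $\mathtt{El}_B,\mathtt{In}_B$ are defined with the same fresh variables in both: $\mathtt{El}_Z=\mathtt{In}_Z=[\ ]$ for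 $Z$ a variable; $\mathtt{El}_{C\supset D}=\mathtt{El}_D[[\ ]x]$, $\mathtt{In}_{C\supset D}=\lambda x.\mathtt{In}_D$; $\mathtt{El}_{\forall X.D}=\mathtt{El}_D[[\ ]X]$, $\mathtt{In}_{\forall X.D}=\Lambda X.\mathtt{In}_D$. (If the rightmost variable is bound in $B$, $\mathsf{at}(B)$ denotes the corresponding type variable used in $\mathtt{El}_B,\mathtt{In}_B$.) ESF-translation: $x^\sharp=x$, $(\lambda x.t)^\sharp=\lambda x.t^\sharp$, $(ts)^\sharp=t^\sharp s^\sharp$, $(\iota_\dagger^{k_0}\langle t_j\rangle)^\sharp=\Lambda X.\lambda\langle x_k\rangle_{k\in\mathcal K}.x_{k_0}\langle t_j^\sharp\rangle$, and for $\delta_\dagger(t,\langle\langle y_j\rangle.s_k\rangle):A$ with $Z=\mathsf{at}(A^*)$, $(\delta_\dagger(t,\langle\langle y_j\rangle.s_k\rangle))^\sharp=\mathtt{In}_{A^*}\{t^\sharp Z\langle\lambda\langle y_j\rangle.\mathtt{El}_{A^*}[s_k^\sharp]\rangle_{k\in\mathcal K}\}$. -}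

module Defs where

open import Data.Fin using (Fin; zero; suc; _≟_; lift)
open import Data.List as List using (List)
open import Data.Nat using (ℕ; zero; suc)
open import Data.Vec using (Vec; []; _∷_; lookup; map; tabulate; fromList; foldr′)
open import Data.Vec.Functional as F using (Vector)
open import Data.Vec.Membership.Propositional using (_∈_)
open import Data.Vec.Relation.Unary.Any using (here; there; index)
open import Function using (id; _∘_)
open import Relation.Binary.PropositionalEquality using (_≡_; refl)

infix  4 _⊢_ _⊢_∶_ _⊢_≃_∶_ _⇝_
infixr 6 _⊃_ _⊃*_
infixl 7 _·_ _∙_
infixl 5 _◁_ _⊕_

-- Everything is well scoped with de Bruijn indices: n counts the type
-- variables in scope, m the term variables.

-- The index lists are the initial segments Fin I, Fin J, Fin K in their
-- natural order.
record Connective : Set where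
  field
    I J K : ℕ
    f     : Fin J → Fin I
    g     : Fin J → Fin K

  fibre : (k : Fin K) → List (Fin J)
  fibre k = List.filter (λ j → g j ≟ k) (List.allFin J)

  arity : Fin K → ℕ
  arity k = List.length (fibre k)

  -- ⟨ A_{f(j)} ⟩ for j ∈ g⁻¹(k).
  premises : {X : Set} → Vector X I → (k : Fin K) → Vec X (arity k)
  premises A k = map (A ∘ f) (fromList (fibre k))

open Connective public using (I; J; K; arity; premises)

-- In λ⟨x_a⟩.t the first variable of the list is bound outermost, so the
-- first entry of As is the first one pushed onto Γ.  The recursion on p
-- in _⊕_ accumulates accordingly.

_⊕_ : ℕ → ℕ → ℕ
zero  ⊕ m = m
suc p ⊕ m = p ⊕ suc m

_◁_ : ∀ {X : Set} {m p} → Vec X m → Vec X p → Vec X (p ⊕ m)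
Γ ◁ []       = Γ
Γ ◁ (A ∷ As) = (A ∷ Γ) ◁ As

data Formᵖ (n : ℕ) : Set where
  var : Fin n → Formᵖ n
  _⊃_ : Formᵖ n → Formᵖ n → Formᵖ n
  †   : (c : Connective) → Vector (Formᵖ n) (I c) → Formᵖ n

data Form² (n : ℕ) : Set where
  var : Fin n → Form² n
  _⊃_ : Form² n → Form² n → Form² n
  ∀′  : Form² (suc n) → Form² n

renF : ∀ {n n′} → (Fin n → Fin n′) → Form² n → Form² n′
renF ρ (var X) = var (ρ X)
renF ρ (A ⊃ B) = renF ρ A ⊃ renF ρ B
renF ρ (∀′ A)  = ∀′ (renF (lift 1 ρ) A)

inst : ∀ {n} → Fin n → Fin (suc n) → Fin n
inst Y zero    = Y
inst Y (suc X) = X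

_⟦_⟧F : ∀ {n} → Form² (suc n) → Fin n → Form² n
A ⟦ Y ⟧F = renF (inst Y) A

_⊃*_ : ∀ {n p} → Vec (Form² n) p → Form² n → Form² n
As ⊃* B = foldr′ _⊃_ B As

Ctxᵖ : ℕ → ℕ → Set
Ctxᵖ n m = Vec (Formᵖ n) m

-- Terms of NIᵖ represent derivations, so they are intrinsically typed.
data _⊢_ {n m} (Γ : Ctxᵖ n m) : Formᵖ n → Set where
  var : ∀ {A} → A ∈ Γ → Γ ⊢ A
  ƛ   : ∀ {A B} → A ∷ Γ ⊢ B → Γ ⊢ A ⊃ B
  _·_ : ∀ {A B} → Γ ⊢ A ⊃ B → Γ ⊢ A → Γ ⊢ B
  ι   : ∀ {c A} (k : Fin (K c)) →
        (∀ i → Γ ⊢ lookup (premises c A k) i) → Γ ⊢ † c A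
  δ   : ∀ {c A C} → Γ ⊢ † c A →
        (∀ k → Γ ◁ premises c A k ⊢ C) → Γ ⊢ C

Renᵖ Subᵖ : ∀ {n m m′} → Ctxᵖ n m → Ctxᵖ n m′ → Set
Renᵖ Γ Δ = ∀ {A} → A ∈ Γ → A ∈ Δ
Subᵖ Γ Δ = ∀ {A} → A ∈ Γ → Δ ⊢ A

module _ {n : ℕ} where

  liftRᵖ : ∀ {m m′} {Γ : Ctxᵖ n m} {Δ : Ctxᵖ n m′} {B} →
           Renᵖ Γ Δ → Renᵖ (B ∷ Γ) (B ∷ Δ)
  liftRᵖ ρ (here eq) = here eq
  liftRᵖ ρ (there x) = there (ρ x)

  liftRᵖ* : ∀ {m m′ p} {Γ : Ctxᵖ n m} {Δ : Ctxᵖ n m′} (Bs : Vec (Formᵖ n) p) →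
            Renᵖ Γ Δ → Renᵖ (Γ ◁ Bs) (Δ ◁ Bs)
  liftRᵖ* []       ρ = ρ
  liftRᵖ* (B ∷ Bs) ρ = liftRᵖ* Bs (liftRᵖ ρ)

  renᵖ : ∀ {m m′} {Γ : Ctxᵖ n m} {Δ : Ctxᵖ n m′} {A} → Renᵖ Γ Δ → Γ ⊢ A → Δ ⊢ A
  renᵖ ρ (var x)               = var (ρ x)
  renᵖ ρ (ƛ t)                 = ƛ (renᵖ (liftRᵖ ρ) t)
  renᵖ ρ (t · u)               = renᵖ ρ t · renᵖ ρ u
  renᵖ ρ (ι k ts)              = ι k (λ i → renᵖ ρ (ts i))
  renᵖ ρ (δ {c = c} {A} t ss) =
    δ (renᵖ ρ t) (λ k → renᵖ (liftRᵖ* (premises c A k) ρ) (ss k))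

  liftSᵖ : ∀ {m m′} {Γ : Ctxᵖ n m} {Δ : Ctxᵖ n m′} {B} →
           Subᵖ Γ Δ → Subᵖ (B ∷ Γ) (B ∷ Δ)
  liftSᵖ σ (here eq) = var (here eq)
  liftSᵖ σ (there x) = renᵖ there (σ x)

  liftSᵖ* : ∀ {m m′ p} {Γ : Ctxᵖ n m} {Δ : Ctxᵖ n m′} (Bs : Vec (Formᵖ n) p) →
            Subᵖ Γ Δ → Subᵖ (Γ ◁ Bs) (Δ ◁ Bs)
  liftSᵖ* []       σ = σ
  liftSᵖ* (B ∷ Bs) σ = liftSᵖ* Bs (liftSᵖ σ)

  subᵖ : ∀ {m m′} {Γ : Ctxᵖ n m} {Δ : Ctxᵖ n m′} {A} → Subᵖ Γ Δ → Γ ⊢ A → Δ ⊢ A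
  subᵖ σ (var x)               = σ x
  subᵖ σ (ƛ t)                 = ƛ (subᵖ (liftSᵖ σ) t)
  subᵖ σ (t · u)               = subᵖ σ t · subᵖ σ u
  subᵖ σ (ι k ts)              = ι k (λ i → subᵖ σ (ts i))
  subᵖ σ (δ {c = c} {A} t ss) =
    δ (subᵖ σ t) (λ k → subᵖ (liftSᵖ* (premises c A k) σ) (ss k))

  wkᵖ* : ∀ {m p} {Γ : Ctxᵖ n m} (Bs : Vec (Formᵖ n) p) → Renᵖ Γ (Γ ◁ Bs)
  wkᵖ* []       x = x
  wkᵖ* (B ∷ Bs) x = wkᵖ* Bs (there x)

  bound : ∀ {m p} {Γ : Ctxᵖ n m} (Bs : Vec (Formᵖ n) p) (i : Fin p) →
          lookup Bs i ∈ Γ ◁ Bs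
  bound (B ∷ Bs) zero    = wkᵖ* Bs (here refl)
  bound (B ∷ Bs) (suc i) = bound Bs i

  consSᵖ : ∀ {m m′} {Γ : Ctxᵖ n m} {Δ : Ctxᵖ n m′} {B} →
           Subᵖ Γ Δ → Δ ⊢ B → Subᵖ (B ∷ Γ) Δ
  consSᵖ σ t (here refl) = t
  consSᵖ σ t (there x)   = σ x

  consSᵖ* : ∀ {m m′ p} {Γ : Ctxᵖ n m} {Δ : Ctxᵖ n m′} (Bs : Vec (Formᵖ n) p) →
            Subᵖ Γ Δ → (∀ i → Δ ⊢ lookup Bs i) → Subᵖ (Γ ◁ Bs) Δ
  consSᵖ* []       σ ts = σ
  consSᵖ* (B ∷ Bs) σ ts = consSᵖ* Bs (consSᵖ σ (ts zero)) (ts ∘ suc)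

  _⟦_⟧ᵖ : ∀ {m} {Γ : Ctxᵖ n m} {A B} → B ∷ Γ ⊢ A → Γ ⊢ B → Γ ⊢ A
  t ⟦ s ⟧ᵖ = subᵖ (consSᵖ var s) t

  subst* : ∀ {m p} {Γ : Ctxᵖ n m} {A} (Bs : Vec (Formᵖ n) p) →
           Γ ◁ Bs ⊢ A → (∀ i → Γ ⊢ lookup Bs i) → Γ ⊢ A
  subst* Bs t ts = subᵖ (consSᵖ* Bs var ts) t

-- D is the type of the hole.
data ECtx {n m} (Γ : Ctxᵖ n m) (D : Formᵖ n) : Formᵖ n → Set where
  []  : ECtx Γ D D
  _·_ : ∀ {A B} → ECtx Γ D (A ⊃ B) → Γ ⊢ A → ECtx Γ D B
  δ   : ∀ {c A C} → ECtx Γ D († c A) →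
        (∀ k → Γ ◁ premises c A k ⊢ C) → ECtx Γ D C

module _ {n : ℕ} where

  _[_]ᴱ : ∀ {m} {Γ : Ctxᵖ n m} {D A} → ECtx Γ D A → Γ ⊢ D → Γ ⊢ A
  []     [ t ]ᴱ = t
  (E · u) [ t ]ᴱ = (E [ t ]ᴱ) · u
  δ E ss  [ t ]ᴱ = δ (E [ t ]ᴱ) ss

  renᴱ : ∀ {m m′} {Γ : Ctxᵖ n m} {Δ : Ctxᵖ n m′} {D A} →
         Renᵖ Γ Δ → ECtx Γ D A → ECtx Δ D A
  renᴱ ρ []                    = []
  renᴱ ρ (E · u)               = renᴱ ρ E · renᵖ ρ u
  renᴱ ρ (δ {c = c} {A} E ss) =
    δ (renᴱ ρ E) (λ k → renᵖ (liftRᵖ* (premises c A k) ρ) (ss k))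

-- Children are compared pointwise in ι-cong and δ-cong, so terms that
-- differ only by pointwise equal families of children are related; no
-- function extensionality is needed to apply the axioms.
data _⇝_ {n m} {Γ : Ctxᵖ n m} : ∀ {A} → Γ ⊢ A → Γ ⊢ A → Set where
  reflexive  : ∀ {A} {t : Γ ⊢ A} → t ⇝ t
  transitive : ∀ {A} {t u v : Γ ⊢ A} → t ⇝ u → u ⇝ v → t ⇝ v

  ƛ-cong : ∀ {A B} {t t′ : A ∷ Γ ⊢ B} → t ⇝ t′ → ƛ t ⇝ ƛ t′
  ·-cong : ∀ {A B} {t t′ : Γ ⊢ A ⊃ B} {u u′ : Γ ⊢ A} →
           t ⇝ t′ → u ⇝ u′ → t · u ⇝ t′ · u′
  ι-cong : ∀ {c A} {k : Fin (K c)} {ts ts′ : ∀ i → Γ ⊢ lookup (premises c A k) i} →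
           (∀ i → ts i ⇝ ts′ i) → ι {c = c} {A} k ts ⇝ ι k ts′
  δ-cong : ∀ {c A C} {t t′ : Γ ⊢ † c A} {ss ss′ : ∀ k → Γ ◁ premises c A k ⊢ C} →
           t ⇝ t′ → (∀ k → ss k ⇝ ss′ k) → δ {c = c} {A} t ss ⇝ δ t′ ss′

  ⊃β : ∀ {A B} (t : A ∷ Γ ⊢ B) (s : Γ ⊢ A) → ƛ t · s ⇝ t ⟦ s ⟧ᵖ
  †β : ∀ {c A C} (h : Fin (K c)) (ts : ∀ i → Γ ⊢ lookup (premises c A h) i)
       (ss : ∀ k → Γ ◁ premises c A k ⊢ C) →
       δ {c = c} {A} (ι h ts) ss ⇝ subst* (premises c A h) (ss h) ts
  ⊃η : ∀ {A B} (t : Γ ⊢ A ⊃ B) → ƛ (renᵖ there t · var (here refl)) ⇝ t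
  †η : ∀ {c A} (t : Γ ⊢ † c A) →
       δ {c = c} {A} t (λ k → ι k (λ i → var (bound (premises c A k) i))) ⇝ t
  †γ : ∀ {c A C D} (E : ECtx Γ C D) (t : Γ ⊢ † c A)
       (ss : ∀ k → Γ ◁ premises c A k ⊢ C) →
       E [ δ {c = c} {A} t ss ]ᴱ ⇝ δ t (λ k → renᴱ (wkᵖ* (premises c A k)) E [ ss k ]ᴱ)

-- Terms of NI²at are Church-style: the annotation on ƛ is the type
-- information left undisplayed on paper, so that a term determines its
-- derivation in a given context.  Only type variables instantiate ∀′.
data Term² (n m : ℕ) : Set where
  var : Fin m → Term² n m
  ƛ   : Form² n → Term² n (suc m) → Term² n m
  _·_ : Term² n m → Term² n m → Term² n m
  Λ   : Term² (suc n) m → Term² n m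
  _∙_ : Term² n m → Fin n → Term² n m

ren² : ∀ {n n′ m m′} → (Fin n → Fin n′) → (Fin m → Fin m′) →
       Term² n m → Term² n′ m′
ren² ρ ξ (var x) = var (ξ x)
ren² ρ ξ (ƛ A t) = ƛ (renF ρ A) (ren² ρ (lift 1 ξ) t)
ren² ρ ξ (t · u) = ren² ρ ξ t · ren² ρ ξ u
ren² ρ ξ (Λ t)   = Λ (ren² (lift 1 ρ) ξ t)
ren² ρ ξ (t ∙ Y) = ren² ρ ξ t ∙ ρ Y

wk : ∀ {n m} → Term² n m → Term² n (suc m)
wk = ren² id suc

wkT : ∀ {n m} → Term² n m → Term² (suc n) m
wkT = ren² suc id

liftS² : ∀ {n m m′} → (Fin m → Term² n m′) → Fin (suc m) → Term² n (suc m′)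
liftS² σ zero    = var zero
liftS² σ (suc x) = wk (σ x)

sub² : ∀ {n m m′} → (Fin m → Term² n m′) → Term² n m → Term² n m′
sub² σ (var x) = σ x
sub² σ (ƛ A t) = ƛ A (sub² (liftS² σ) t)
sub² σ (t · u) = sub² σ t · sub² σ u
sub² σ (Λ t)   = Λ (sub² (wkT ∘ σ) t)
sub² σ (t ∙ Y) = sub² σ t ∙ Y

_⟦_⟧ : ∀ {n m} → Term² n (suc m) → Term² n m → Term² n m
t ⟦ s ⟧ = sub² (s F.∷ var) t

_⟦_⟧T : ∀ {n m} → Term² (suc n) m → Fin n → Term² n m
t ⟦ Y ⟧T = ren² (inst Y) id t

Ctx² : ℕ → ℕ → Set
Ctx² n m = Vec (Form² n) m

data _⊢_∶_ {n m} (Γ : Ctx² n m) : Term² n m → Form² n → Set where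
  var : ∀ x → Γ ⊢ var x ∶ lookup Γ x
  ƛ   : ∀ {A B t} → A ∷ Γ ⊢ t ∶ B → Γ ⊢ ƛ A t ∶ A ⊃ B
  _·_ : ∀ {A B t u} → Γ ⊢ t ∶ A ⊃ B → Γ ⊢ u ∶ A → Γ ⊢ t · u ∶ B
  Λ   : ∀ {A t} → map (renF suc) Γ ⊢ t ∶ A → Γ ⊢ Λ t ∶ ∀′ A
  _∙_ : ∀ {A t} → Γ ⊢ t ∶ ∀′ A → ∀ Y → Γ ⊢ t ∙ Y ∶ A ⟦ Y ⟧F

data _⊢_≃_∶_ {n m} (Γ : Ctx² n m) : Term² n m → Term² n m → Form² n → Set where
  reflexive  : ∀ {A t} → Γ ⊢ t ∶ A → Γ ⊢ t ≃ t ∶ A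
  symmetric  : ∀ {A t u} → Γ ⊢ t ≃ u ∶ A → Γ ⊢ u ≃ t ∶ A
  transitive : ∀ {A t u v} → Γ ⊢ t ≃ u ∶ A → Γ ⊢ u ≃ v ∶ A → Γ ⊢ t ≃ v ∶ A

  ƛ-cong : ∀ {A B t t′} → A ∷ Γ ⊢ t ≃ t′ ∶ B → Γ ⊢ ƛ A t ≃ ƛ A t′ ∶ A ⊃ B
  ·-cong : ∀ {A B t t′ u u′} → Γ ⊢ t ≃ t′ ∶ A ⊃ B → Γ ⊢ u ≃ u′ ∶ A →
           Γ ⊢ t · u ≃ t′ · u′ ∶ B
  Λ-cong : ∀ {A t t′} → map (renF suc) Γ ⊢ t ≃ t′ ∶ A → Γ ⊢ Λ t ≃ Λ t′ ∶ ∀′ A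
  ∙-cong : ∀ {A t t′} → Γ ⊢ t ≃ t′ ∶ ∀′ A → ∀ Y → Γ ⊢ t ∙ Y ≃ t′ ∙ Y ∶ A ⟦ Y ⟧F

  ⊃β : ∀ {A B t s} → A ∷ Γ ⊢ t ∶ B → Γ ⊢ s ∶ A → Γ ⊢ ƛ A t · s ≃ t ⟦ s ⟧ ∶ B
  ∀β : ∀ {A t} → map (renF suc) Γ ⊢ t ∶ A → ∀ Y →
       Γ ⊢ Λ t ∙ Y ≃ t ⟦ Y ⟧T ∶ A ⟦ Y ⟧F
  ⊃η : ∀ {A B t} → Γ ⊢ t ∶ A ⊃ B → Γ ⊢ ƛ A (wk t · var zero) ≃ t ∶ A ⊃ B
  ∀η : ∀ {A t} → Γ ⊢ t ∶ ∀′ A → Γ ⊢ Λ (wkT t ∙ zero) ≃ t ∶ ∀′ A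

lift* : ∀ {m m′} p → (Fin m → Fin m′) → Fin (p ⊕ m) → Fin (p ⊕ m′)
lift* zero    ξ = ξ
lift* (suc p) ξ = lift* p (lift 1 ξ)

wk* : ∀ {m} p → Fin m → Fin (p ⊕ m)
wk* zero    x = x
wk* (suc p) x = wk* p (suc x)

bound² : ∀ {m p} → Fin p → Fin (p ⊕ m)
bound² {p = suc p} zero    = wk* p zero
bound² {p = suc p} (suc i) = bound² i

ƛ* : ∀ {n m p} → Vec (Form² n) p → Term² n (p ⊕ m) → Term² n m
ƛ* []       t = t
ƛ* (A ∷ As) t = ƛ A (ƛ* As t)

_·*_ : ∀ {n m p} → Term² n m → Vector (Term² n m) p → Term² n m
t ·* us = F.foldl _·_ t us

-- ⟨B_j⟩_{j ∈ g⁻¹(k)} ⊃ X for each k, where B_j = A_{f(j)} weakened by the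
-- fresh variable X = zero.
clauses : ∀ {n} (c : Connective) → Vector (Form² n) (I c) →
          Vec (Form² (suc n)) (K c)
clauses c A = tabulate (λ k → premises c (renF suc ∘ A) k ⊃* var zero)

_⋆ : ∀ {n} → Formᵖ n → Form² n
var X ⋆   = var X
(A ⊃ B) ⋆ = (A ⋆) ⊃ (B ⋆)
† c A ⋆   = ∀′ (clauses c (λ i → A i ⋆) ⊃* var zero)

-- The scope at the hole of In_B: the ambient scope extended by the fresh
-- variables of B.
tyScope : ∀ {n} → Form² n → ℕ
tyScope {n} (var Z) = n
tyScope (C ⊃ D)     = tyScope D
tyScope (∀′ D)      = tyScope D

tmScope : ∀ {n} → Form² n → ℕ → ℕ
tmScope (var Z) m = m
tmScope (C ⊃ D) m = tmScope D (suc m)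
tmScope (∀′ D)  m = tmScope D m

tyWk : ∀ {n} (B : Form² n) → Fin n → Fin (tyScope B)
tyWk (var Z) X = X
tyWk (C ⊃ D) X = tyWk D X
tyWk (∀′ D)  X = tyWk D (suc X)

tmWk : ∀ {n m} (B : Form² n) → Fin m → Fin (tmScope B m)
tmWk (var Z) x = x
tmWk (C ⊃ D) x = tmWk D (suc x)
tmWk (∀′ D)  x = tmWk D x

-- at lives in the scope of In_B, so a rightmost variable that is bound in B
-- denotes the fresh variable used for it in El_B and In_B.
at : ∀ {n} (B : Form² n) → Fin (tyScope B)
at (var Z) = Z
at (C ⊃ D) = at D
at (∀′ D)  = at D

-- In_B{t}: the free variables of t coming from the extended scope are
-- captured.
In : ∀ {n m} (B : Form² n) → Term² (tyScope B) (tmScope B m) → Term² n m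
In (var Z) t = t
In (C ⊃ D) t = ƛ C (In D t)
In (∀′ D)  t = Λ (In D t)

-- El_B[t], used below p further binders placed between the fresh
-- variables of B and the hole; t does not mention the fresh variables and
-- is weakened past them.
El : ∀ {n m} p (B : Form² n) → Term² n (p ⊕ m) →
     Term² (tyScope B) (p ⊕ tmScope B m)
El p (var Z) t = t
El p (C ⊃ D) t = El p D (ren² id (lift* p suc) t · var (wk* p zero))
El p (∀′ D)  t = El p D (wkT t ∙ zero)

_♯ : ∀ {n m} {Γ : Ctxᵖ n m} {A} → Γ ⊢ A → Term² n m
var x ♯            = var (index x)
ƛ {A = A} t ♯      = ƛ (A ⋆) (t ♯)
(t · u) ♯          = (t ♯) · (u ♯)
ι {c} {A} k ts ♯   =
  Λ (ƛ* (clauses c (λ i → A i ⋆))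
        (var (bound² k) ·* (λ i → ren² suc (wk* (K c)) (ts i ♯))))
δ {c} {A} {C} t ss ♯ =
  In B ((ren² (tyWk B) (tmWk B) (t ♯) ∙ at B) ·* (λ k →
    ƛ* (premises c (λ i → renF (tyWk B) (A i ⋆)) k) (El (arity c k) B (ss k ♯))))
  where
  B = C ⋆

{-# OPTIONS --safe #-}
module Submission where

-- The translation of a connective is an impredicative sum: inj below is the
-- translation of ι, and the translation of δ at type B, In_B around an
-- application to branches in El_B, is restated as a term case B t Ps ss
-- defined by recursion on B (In-El, δ-♯).  In this form the fresh variables
-- of B are introduced one at a time, and every property of δ is proved for an
-- arbitrary target B by induction on B, or by unfolding one connective of B.
--
-- Each conversion then becomes a statement about case:
--   * β (case-β): when B is a variable the term β-reduces to the chosen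
--     branch; under ⊃ and ∀ the induction hypothesis leaves an η-expansion of
--     the instantiated branch.
--   * γ for an application frame (γ-·): case at A ⊃ B is an abstraction whose
--     body is case at B with the bound variable fed to every branch, so one
--     β-step moves the argument into the branches.  γ-∙ is the same for type
--     application, and γ-Sum-elim combines the two.
--   * γ for a δ frame (γ-case): by induction on the type C of the outer case.
--     At a variable this is γ-Sum-elim; under ⊃ and ∀, γ-· and γ-∙ undo the
--     expansion of the inner case on the right.  A general elimination
--     context is treated frame by frame (†γ-♯).
--   * η (case-η): both sides are η-expanded at the sum type by Sum-η, and then
--     the left one is eliminated by γ-Sum-elim and inj-β, which leaves
--     η-expansions of the variables that stand for the branches.
--
-- What remains is that the translation commutes with renaming and
-- substitution on the nose (♯-ren, ♯-sub), that it preserves typing (♯-⊢), and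
-- that ι and δ translate to constructs compatible with conversion (inj-≃,
-- case-≃).  Compatibility with conversion yields typing too, because only
-- typed terms are related (≃-⊢).

open import Data.Fin using (Fin; zero; suc; lift)
open import Data.Nat using (ℕ; zero; suc)
open import Data.Product using (_×_; _,_; proj₁; proj₂)
open import Data.Vec using (Vec; []; _∷_; lookup; map; tabulate; fromList)
open import Data.Vec.Properties
  using (map-cong; map-id; map-∘; lookup-map; lookup∘tabulate; tabulate-cong; tabulate-∘)
open import Data.Vec.Functional as F using (Vector)
open import Data.Vec.Membership.Propositional using (_∈_)
open import Data.Vec.Relation.Unary.Any using (here; there; index)
open import Function using (id; _∘_)
open import Relation.Binary.PropositionalEquality
  using (_≡_; _≗_; refl; sym; trans; cong; cong₂; subst; subst₂; module ≡-Reasoning)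
open import Defs

-- Renaming type variables.

lift-id : ∀ {n} {ρ : Fin n → Fin n} → ρ ≗ id → lift 1 ρ ≗ id
lift-id e zero    = refl
lift-id e (suc x) = cong suc (e x)

lift-∘ : ∀ {n₁ n₂ n₃} {ρ : Fin n₂ → Fin n₃} {ρ′ : Fin n₁ → Fin n₂} {τ} →
         ρ ∘ ρ′ ≗ τ → lift 1 ρ ∘ lift 1 ρ′ ≗ lift 1 τ
lift-∘ e zero    = refl
lift-∘ e (suc x) = cong suc (e x)

renF-id : ∀ {n} {ρ : Fin n → Fin n} → ρ ≗ id → renF ρ ≗ id
renF-id e (var X) = cong var (e X)
renF-id e (A ⊃ B) = cong₂ _⊃_ (renF-id e A) (renF-id e B)
renF-id e (∀′ A)  = cong ∀′ (renF-id (lift-id e) A)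

-- Here and below a composition lemma takes the composite as a separate map τ,
-- so that it applies to any factorization that holds pointwise.
renF-∘ : ∀ {n₁ n₂ n₃} {ρ : Fin n₂ → Fin n₃} {ρ′ : Fin n₁ → Fin n₂} {τ} →
         ρ ∘ ρ′ ≗ τ → renF ρ ∘ renF ρ′ ≗ renF τ
renF-∘ e (var X) = cong var (e X)
renF-∘ e (A ⊃ B) = cong₂ _⊃_ (renF-∘ e A) (renF-∘ e B)
renF-∘ e (∀′ A)  = cong ∀′ (renF-∘ (lift-∘ e) A)

renF-suc : ∀ {n n′} (ρ : Fin n → Fin n′) A →
           renF (lift 1 ρ) (renF suc A) ≡ renF suc (renF ρ A)
renF-suc ρ A = trans (renF-∘ (λ _ → refl) A) (sym (renF-∘ (λ _ → refl) A))

inst-lift : ∀ {n n′} (ρ : Fin n → Fin n′) Y → inst (ρ Y) ∘ lift 1 ρ ≗ ρ ∘ inst Y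
inst-lift ρ Y zero    = refl
inst-lift ρ Y (suc x) = refl

renF-inst : ∀ {n n′} (ρ : Fin n → Fin n′) A Y →
            renF (lift 1 ρ) A ⟦ ρ Y ⟧F ≡ renF ρ (A ⟦ Y ⟧F)
renF-inst ρ A Y = trans (renF-∘ (inst-lift ρ Y) A) (sym (renF-∘ (λ _ → refl) A))

inst-suc : ∀ {n} → inst zero ∘ lift 1 suc ≗ id {A = Fin (suc n)}
inst-suc zero    = refl
inst-suc (suc x) = refl

renF-inst-suc : ∀ {n} (A : Form² (suc n)) → renF (lift 1 suc) A ⟦ zero ⟧F ≡ A
renF-inst-suc A = trans (renF-∘ inst-suc A) (renF-id (λ _ → refl) A)

renF-suc-inst : ∀ {n} (A : Form² n) Y → renF suc A ⟦ Y ⟧F ≡ A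
renF-suc-inst A Y = trans (renF-∘ (λ _ → refl) A) (renF-id (λ _ → refl) A)

renF-⊃* : ∀ {n n′ p} (ρ : Fin n → Fin n′) (As : Vec (Form² n) p) B →
          renF ρ (As ⊃* B) ≡ map (renF ρ) As ⊃* renF ρ B
renF-⊃* ρ []       B = refl
renF-⊃* ρ (A ∷ As) B = cong (renF ρ A ⊃_) (renF-⊃* ρ As B)

map-fuse : ∀ {X Y Z : Set} {f : Y → Z} {g : X → Y} {h : X → Z} → f ∘ g ≗ h →
           ∀ {p} (xs : Vec X p) → map f (map g xs) ≡ map h xs
map-fuse e xs = trans (sym (map-∘ _ _ xs)) (map-cong e xs)

map-id′ : ∀ {X : Set} {f : X → X} → f ≗ id → ∀ {p} (xs : Vec X p) → map f xs ≡ xs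
map-id′ e xs = trans (map-cong e xs) (map-id xs)

map-renF-id : ∀ {n p} (As : Vec (Form² n) p) → map (renF id) As ≡ As
map-renF-id = map-id′ (renF-id (λ _ → refl))

map-renF-suc : ∀ {n n′ p} (ρ : Fin n → Fin n′) (As : Vec (Form² n) p) →
               map (renF (lift 1 ρ)) (map (renF suc) As) ≡ map (renF suc) (map (renF ρ) As)
map-renF-suc ρ As = trans (map-fuse (renF-suc ρ) As) (map-∘ _ _ As)

-- Renaming and substitution in terms.

ren²-id : ∀ {n m} {ρ : Fin n → Fin n} {ξ : Fin m → Fin m} → ρ ≗ id → ξ ≗ id → ren² ρ ξ ≗ id
ren²-id e f (var x) = cong var (f x)
ren²-id e f (ƛ A t) = cong₂ ƛ (renF-id e A) (ren²-id e (lift-id f) t)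
ren²-id e f (t · u) = cong₂ _·_ (ren²-id e f t) (ren²-id e f u)
ren²-id e f (Λ t)   = cong Λ (ren²-id (lift-id e) f t)
ren²-id e f (t ∙ Y) = cong₂ _∙_ (ren²-id e f t) (e Y)

ren²-∘ : ∀ {n₁ n₂ n₃ m₁ m₂ m₃} {ρ : Fin n₂ → Fin n₃} {ρ′ : Fin n₁ → Fin n₂} {τ}
         {ξ : Fin m₂ → Fin m₃} {ξ′ : Fin m₁ → Fin m₂} {ζ} →
         ρ ∘ ρ′ ≗ τ → ξ ∘ ξ′ ≗ ζ → ren² ρ ξ ∘ ren² ρ′ ξ′ ≗ ren² τ ζ
ren²-∘ e f (var x) = cong var (f x)
ren²-∘ e f (ƛ A t) = cong₂ ƛ (renF-∘ e A) (ren²-∘ e (lift-∘ f) t)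
ren²-∘ e f (t · u) = cong₂ _·_ (ren²-∘ e f t) (ren²-∘ e f u)
ren²-∘ e f (Λ t)   = cong Λ (ren²-∘ (lift-∘ e) f t)
ren²-∘ e f (t ∙ Y) = cong₂ _∙_ (ren²-∘ e f t) (e Y)

ren²-cong : ∀ {n n′ m m′} {ρ τ : Fin n → Fin n′} {ξ ζ : Fin m → Fin m′} →
            ρ ≗ τ → ξ ≗ ζ → ren² ρ ξ ≗ ren² τ ζ
ren²-cong e f t = trans (sym (ren²-id (λ _ → refl) (λ _ → refl) (ren² _ _ t))) (ren²-∘ e f t)

ren²-square : ∀ {n₁ n₂ n₂′ n₃ m₁ m₂ m₂′ m₃}
  {ρ : Fin n₂ → Fin n₃} {ρ′ : Fin n₁ → Fin n₂} {τ : Fin n₂′ → Fin n₃} {τ′ : Fin n₁ → Fin n₂′}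
  {ξ : Fin m₂ → Fin m₃} {ξ′ : Fin m₁ → Fin m₂} {ζ : Fin m₂′ → Fin m₃} {ζ′ : Fin m₁ → Fin m₂′} →
  ρ ∘ ρ′ ≗ τ ∘ τ′ → ξ ∘ ξ′ ≗ ζ ∘ ζ′ → ren² ρ ξ ∘ ren² ρ′ ξ′ ≗ ren² τ ζ ∘ ren² τ′ ζ′
ren²-square e f t = trans (ren²-∘ e f t) (sym (ren²-∘ (λ _ → refl) (λ _ → refl) t))

-- Simultaneous renaming of type variables by ρ and substitution of terms by
-- σ.  It subsumes ren² and sub².
msub : ∀ {n n′ m m′} → (Fin n → Fin n′) → (Fin m → Term² n′ m′) → Term² n m → Term² n′ m′
msub ρ σ (var x) = σ x
msub ρ σ (ƛ A t) = ƛ (renF ρ A) (msub ρ (liftS² σ) t)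
msub ρ σ (t · u) = msub ρ σ t · msub ρ σ u
msub ρ σ (Λ t)   = Λ (msub (lift 1 ρ) (wkT ∘ σ) t)
msub ρ σ (t ∙ Y) = msub ρ σ t ∙ ρ Y

ren²≗msub : ∀ {n n′ m m′} {ρ : Fin n → Fin n′} {ξ : Fin m → Fin m′} {σ} →
            (∀ x → var (ξ x) ≡ σ x) → ren² ρ ξ ≗ msub ρ σ
ren²≗msub e (var x) = e x
ren²≗msub {ρ = ρ} {ξ} {σ} e (ƛ A t) = cong (ƛ _) (ren²≗msub e′ t)
  where
  e′ : ∀ x → var (lift 1 ξ x) ≡ liftS² σ x
  e′ zero    = refl
  e′ (suc x) = cong wk (e x)
ren²≗msub e (t · u) = cong₂ _·_ (ren²≗msub e t) (ren²≗msub e u)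
ren²≗msub e (Λ t)   = cong Λ (ren²≗msub (λ x → cong wkT (e x)) t)
ren²≗msub e (t ∙ Y) = cong (_∙ _) (ren²≗msub e t)

sub²≗msub : ∀ {n m m′} {ρ : Fin n → Fin n} {σ : Fin m → Term² n m′} →
            ρ ≗ id → sub² σ ≗ msub ρ σ
sub²≗msub e (var x) = refl
sub²≗msub e (ƛ A t) = cong₂ ƛ (sym (renF-id e A)) (sub²≗msub e t)
sub²≗msub e (t · u) = cong₂ _·_ (sub²≗msub e t) (sub²≗msub e u)
sub²≗msub e (Λ t)   = cong Λ (sub²≗msub (lift-id e) t)
sub²≗msub e (t ∙ Y) = cong₂ _∙_ (sub²≗msub e t) (sym (e Y))

msub-id : ∀ {n m} {ρ : Fin n → Fin n} {σ : Fin m → Term² n m} →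
          ρ ≗ id → (∀ x → var x ≡ σ x) → msub ρ σ ≗ id
msub-id e f t = trans (sym (ren²≗msub f t)) (ren²-id e (λ _ → refl) t)

msub-ren² : ∀ {n₁ n₂ n₃ m₁ m₂ m₃} {ρ : Fin n₂ → Fin n₃} {ρ′ : Fin n₁ → Fin n₂} {τ}
            {σ : Fin m₂ → Term² n₃ m₃} {ξ : Fin m₁ → Fin m₂} {θ} →
            ρ ∘ ρ′ ≗ τ → σ ∘ ξ ≗ θ → msub ρ σ ∘ ren² ρ′ ξ ≗ msub τ θ
msub-ren² e f (var x) = f x
msub-ren² {σ = σ} {ξ} {θ} e f (ƛ A t) = cong₂ ƛ (renF-∘ e A) (msub-ren² e f′ t)
  where
  f′ : liftS² σ ∘ lift 1 ξ ≗ liftS² θ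
  f′ zero    = refl
  f′ (suc x) = cong wk (f x)
msub-ren² e f (t · u) = cong₂ _·_ (msub-ren² e f t) (msub-ren² e f u)
msub-ren² e f (Λ t)   = cong Λ (msub-ren² (lift-∘ e) (λ x → cong wkT (f x)) t)
msub-ren² e f (t ∙ Y) = cong₂ _∙_ (msub-ren² e f t) (e Y)

ren²-msub : ∀ {n₁ n₂ n₃ m₁ m₂ m₃} {ρ : Fin n₂ → Fin n₃} {ρ′ : Fin n₁ → Fin n₂} {τ}
            {ξ : Fin m₂ → Fin m₃} {σ : Fin m₁ → Term² n₂ m₂} {θ} →
            ρ ∘ ρ′ ≗ τ → ren² ρ ξ ∘ σ ≗ θ → ren² ρ ξ ∘ msub ρ′ σ ≗ msub τ θ
ren²-msub e f (var x) = f x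
ren²-msub {ρ = ρ} {ξ = ξ} {σ} {θ} e f (ƛ A t) = cong₂ ƛ (renF-∘ e A) (ren²-msub e f′ t)
  where
  f′ : ren² ρ (lift 1 ξ) ∘ liftS² σ ≗ liftS² θ
  f′ zero    = refl
  f′ (suc x) = trans (ren²-square (λ _ → refl) (λ _ → refl) (σ x)) (cong wk (f x))
ren²-msub e f (t · u) = cong₂ _·_ (ren²-msub e f t) (ren²-msub e f u)
ren²-msub {σ = σ} e f (Λ t) = cong Λ (ren²-msub (lift-∘ e)
  (λ x → trans (ren²-square (λ _ → refl) (λ _ → refl) (σ x)) (cong wkT (f x))) t)
ren²-msub e f (t ∙ Y) = cong₂ _∙_ (ren²-msub e f t) (e Y)

-- A square of renamings and substitutions that commutes on variables commutes
-- on terms.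
msub-ren²-swap : ∀ {n₁ n₂ n₃ n₄ m₁ m₂ m₃ m₄}
  {ρ : Fin n₁ → Fin n₂} {ρ′ : Fin n₃ → Fin n₄} {τ : Fin n₁ → Fin n₃} {τ′ : Fin n₂ → Fin n₄}
  {σ : Fin m₁ → Term² n₂ m₂} {σ′ : Fin m₃ → Term² n₄ m₄}
  {ξ : Fin m₁ → Fin m₃} {ξ′ : Fin m₂ → Fin m₄} →
  ρ′ ∘ τ ≗ τ′ ∘ ρ → σ′ ∘ ξ ≗ ren² τ′ ξ′ ∘ σ →
  msub ρ′ σ′ ∘ ren² τ ξ ≗ ren² τ′ ξ′ ∘ msub ρ σ
msub-ren²-swap e f t = trans (msub-ren² e f t) (sym (ren²-msub (λ _ → refl) (λ _ → refl) t))

msub-msub : ∀ {n₁ n₂ n₃ m₁ m₂ m₃} {ρ : Fin n₂ → Fin n₃} {ρ′ : Fin n₁ → Fin n₂} {τ}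
            {σ : Fin m₂ → Term² n₃ m₃} {σ′ : Fin m₁ → Term² n₂ m₂} {θ} →
            ρ ∘ ρ′ ≗ τ → msub ρ σ ∘ σ′ ≗ θ → msub ρ σ ∘ msub ρ′ σ′ ≗ msub τ θ
msub-msub e f (var x) = f x
msub-msub {ρ = ρ} {σ = σ} {σ′} {θ} e f (ƛ A t) = cong₂ ƛ (renF-∘ e A) (msub-msub e f′ t)
  where
  f′ : msub ρ (liftS² σ) ∘ liftS² σ′ ≗ liftS² θ
  f′ zero    = refl
  f′ (suc x) = trans (msub-ren²-swap (λ _ → refl) (λ _ → refl) (σ′ x)) (cong wk (f x))
msub-msub e f (t · u) = cong₂ _·_ (msub-msub e f t) (msub-msub e f u)
msub-msub {σ′ = σ′} e f (Λ t) = cong Λ (msub-msub (lift-∘ e)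
  (λ x → trans (msub-ren²-swap (λ _ → refl) (λ _ → refl) (σ′ x)) (cong wkT (f x))) t)
msub-msub e f (t ∙ Y) = cong₂ _∙_ (msub-msub e f t) (e Y)

-- Blocks of variables.

-- Every variable of the scope p ⊕ m is an old one or one of the block.
⊕-elim : ∀ p {m} (P : Fin (p ⊕ m) → Set) →
         (∀ x → P (wk* p x)) → (∀ i → P (bound² {p = p} i)) → ∀ x → P x
⊕-elim zero    P old new = old
⊕-elim (suc p) P old new = ⊕-elim p P
  (λ { zero → new zero ; (suc x) → old x }) (λ i → new (suc i))

lift*-wk* : ∀ {m m′} p (ξ : Fin m → Fin m′) x → lift* p ξ (wk* p x) ≡ wk* p (ξ x)
lift*-wk* zero    ξ x = refl
lift*-wk* (suc p) ξ x = lift*-wk* p (lift 1 ξ) (suc x)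

lift*-bound² : ∀ {m m′ p} (ξ : Fin m → Fin m′) (i : Fin p) → lift* p ξ (bound² i) ≡ bound² i
lift*-bound² {p = suc p} ξ zero    = lift*-wk* p (lift 1 ξ) zero
lift*-bound² {p = suc p} ξ (suc i) = lift*-bound² (lift 1 ξ) i

lift*-square : ∀ {m₁ m₂ m₂′ m₃} p {ξ : Fin m₂ → Fin m₃} {ξ′ : Fin m₁ → Fin m₂}
  {ζ : Fin m₂′ → Fin m₃} {ζ′ : Fin m₁ → Fin m₂′} →
  ξ ∘ ξ′ ≗ ζ ∘ ζ′ → lift* p ξ ∘ lift* p ξ′ ≗ lift* p ζ ∘ lift* p ζ′
lift*-square zero    e = e
lift*-square (suc p) e = lift*-square p (λ { zero → refl ; (suc x) → cong suc (e x) })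

lift*-id : ∀ {m} p → lift* p id ≗ id {A = Fin (p ⊕ m)}
lift*-id p = ⊕-elim p _ (lift*-wk* p id) (lift*-bound² {p = p} id)

-- A substitution lifted past a block, which it leaves fixed.
liftS* : ∀ {n m m′} p → (Fin m → Term² n m′) → Fin (p ⊕ m) → Term² n (p ⊕ m′)
liftS* zero    σ = σ
liftS* (suc p) σ = liftS* p (liftS² σ)

liftS*-wk* : ∀ {n m m′} p (σ : Fin m → Term² n m′) x →
             liftS* p σ (wk* p x) ≡ ren² id (wk* p) (σ x)
liftS*-wk* zero    σ x = sym (ren²-id (λ _ → refl) (λ _ → refl) (σ x))
liftS*-wk* (suc p) σ x = trans (liftS*-wk* p (liftS² σ) (suc x))
                               (ren²-∘ (λ _ → refl) (λ _ → refl) (σ x))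

liftS*-bound² : ∀ {n m m′ p} (σ : Fin m → Term² n m′) (i : Fin p) →
                liftS* p σ (bound² i) ≡ var (bound² i)
liftS*-bound² {p = suc p} σ zero    = liftS*-wk* p (liftS² σ) zero
liftS*-bound² {p = suc p} σ (suc i) = liftS*-bound² (liftS² σ) i

-- A commuting square of renamings and substitutions lifts past a block.
liftS*-ren² : ∀ {n₂ n₄ m₁ m₂ m₃ m₄} p {τ′ : Fin n₂ → Fin n₄}
  {σ : Fin m₁ → Term² n₂ m₂} {σ′ : Fin m₃ → Term² n₄ m₄}
  {ξ : Fin m₁ → Fin m₃} {ξ′ : Fin m₂ → Fin m₄} →
  σ′ ∘ ξ ≗ ren² τ′ ξ′ ∘ σ →
  liftS* p σ′ ∘ lift* p ξ ≗ ren² τ′ (lift* p ξ′) ∘ liftS* p σ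
liftS*-ren² zero    f = f
liftS*-ren² (suc p) {σ = σ} f = liftS*-ren² p
  λ { zero    → refl
    ; (suc x) → trans (cong wk (f x)) (ren²-square (λ _ → refl) (λ _ → refl) (σ x)) }

liftS*-var : ∀ {n m m′} p (ξ : Fin m → Fin m′) (x : Fin (p ⊕ m)) →
             liftS* {n} p (var ∘ ξ) x ≡ var (lift* p ξ x)
liftS*-var p ξ = ⊕-elim p _
  (λ x → trans (liftS*-wk* p _ x) (cong var (sym (lift*-wk* p ξ x))))
  (λ i → trans (liftS*-bound² {p = p} _ i) (cong var (sym (lift*-bound² ξ i))))

-- Instantiates the block by us and maps the old variables by σ.
consS* : ∀ {n m m′ p} → (Fin m → Term² n m′) → Vector (Term² n m′) p → Fin (p ⊕ m) → Term² n m′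
consS* {p = zero}  σ us = σ
consS* {p = suc p} σ us = consS* (us zero F.∷ σ) (us ∘ suc)

consS*-wk* : ∀ {n m m′ p} (σ : Fin m → Term² n m′) (us : Vector (Term² n m′) p) x →
             consS* σ us (wk* p x) ≡ σ x
consS*-wk* {p = zero}  σ us x = refl
consS*-wk* {p = suc p} σ us x = consS*-wk* (us zero F.∷ σ) (us ∘ suc) (suc x)

consS*-bound² : ∀ {n m m′ p} (σ : Fin m → Term² n m′) (us : Vector (Term² n m′) p) i →
                consS* σ us (bound² i) ≡ us i
consS*-bound² {p = suc p} σ us zero    = consS*-wk* (us zero F.∷ σ) (us ∘ suc) zero
consS*-bound² {p = suc p} σ us (suc i) = consS*-bound² (us zero F.∷ σ) (us ∘ suc) i

·*-cong : ∀ {n m p} {t t′ : Term² n m} {us us′ : Vector (Term² n m) p} →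
          t ≡ t′ → us ≗ us′ → t ·* us ≡ t′ ·* us′
·*-cong {p = zero}  e f = e
·*-cong {p = suc p} e f = ·*-cong (cong₂ _·_ e (f zero)) (λ i → f (suc i))

msub-·* : ∀ {n n′ m m′ p} (ρ : Fin n → Fin n′) (σ : Fin m → Term² n′ m′) t
          (us : Vector (Term² n m) p) →
          msub ρ σ (t ·* us) ≡ msub ρ σ t ·* (msub ρ σ ∘ us)
msub-·* {p = zero}  ρ σ t us = refl
msub-·* {p = suc p} ρ σ t us = msub-·* ρ σ (t · us zero) (us ∘ suc)

msub-ƛ* : ∀ {n n′ m m′ p} (ρ : Fin n → Fin n′) (σ : Fin m → Term² n′ m′)
          (As : Vec (Form² n) p) t →
          msub ρ σ (ƛ* As t) ≡ ƛ* (map (renF ρ) As) (msub ρ (liftS* p σ) t)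
msub-ƛ* ρ σ []       t = refl
msub-ƛ* ρ σ (A ∷ As) t = cong (ƛ _) (msub-ƛ* ρ (liftS² σ) As t)

ren²-·* : ∀ {n n′ m m′ p} (ρ : Fin n → Fin n′) (ξ : Fin m → Fin m′) t
          (us : Vector (Term² n m) p) →
          ren² ρ ξ (t ·* us) ≡ ren² ρ ξ t ·* (ren² ρ ξ ∘ us)
ren²-·* {p = zero}  ρ ξ t us = refl
ren²-·* {p = suc p} ρ ξ t us = ren²-·* ρ ξ (t · us zero) (us ∘ suc)

ren²-ƛ* : ∀ {n n′ m m′ p} (ρ : Fin n → Fin n′) (ξ : Fin m → Fin m′)
          (As : Vec (Form² n) p) t →
          ren² ρ ξ (ƛ* As t) ≡ ƛ* (map (renF ρ) As) (ren² ρ (lift* p ξ) t)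
ren²-ƛ* ρ ξ []       t = refl
ren²-ƛ* ρ ξ (A ∷ As) t = cong (ƛ _) (ren²-ƛ* ρ (lift 1 ξ) As t)

lookup-◁-wk* : ∀ {X : Set} {m p} (Γ : Vec X m) (As : Vec X p) x →
               lookup (Γ ◁ As) (wk* p x) ≡ lookup Γ x
lookup-◁-wk* Γ []       x = refl
lookup-◁-wk* Γ (A ∷ As) x = lookup-◁-wk* (A ∷ Γ) As (suc x)

lookup-◁-bound² : ∀ {X : Set} {m p} (Γ : Vec X m) (As : Vec X p) i →
                  lookup (Γ ◁ As) (bound² i) ≡ lookup As i
lookup-◁-bound² Γ (A ∷ As) zero    = lookup-◁-wk* (A ∷ Γ) As zero
lookup-◁-bound² Γ (A ∷ As) (suc i) = lookup-◁-bound² (A ∷ Γ) As i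

map-◁ : ∀ {X Y : Set} {m p} (h : X → Y) (Γ : Vec X m) (As : Vec X p) →
        map h (Γ ◁ As) ≡ map h Γ ◁ map h As
map-◁ h Γ []       = refl
map-◁ h Γ (A ∷ As) = map-◁ h (A ∷ Γ) As

-- Typing and typed equality.

var-⊢ : ∀ {n m} {Γ : Ctx² n m} {x A} → lookup Γ x ≡ A → Γ ⊢ var x ∶ A
var-⊢ refl = var _

≡-⊢ : ∀ {n m} {Γ : Ctx² n m} {t A B} → A ≡ B → Γ ⊢ t ∶ A → Γ ⊢ t ∶ B
≡-⊢ refl d = d

≡-≃ : ∀ {n m} {Γ : Ctx² n m} {t t′ u u′ A} → t ≡ t′ → u ≡ u′ →
      Γ ⊢ t ≃ u ∶ A → Γ ⊢ t′ ≃ u′ ∶ A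
≡-≃ refl refl d = d

≡-≃-type : ∀ {n m} {Γ : Ctx² n m} {t u A B} → A ≡ B → Γ ⊢ t ≃ u ∶ A → Γ ⊢ t ≃ u ∶ B
≡-≃-type refl d = d

-- Renaming along (ρ , ξ) carries derivations in Γ to derivations in Δ.
Renames : ∀ {n n′ m m′} → (Fin n → Fin n′) → (Fin m → Fin m′) → Ctx² n m → Ctx² n′ m′ → Set
Renames ρ ξ Γ Δ = ∀ x → lookup Δ (ξ x) ≡ renF ρ (lookup Γ x)

Renames-lift : ∀ {n n′ m m′ ρ ξ} {Γ : Ctx² n m} {Δ : Ctx² n′ m′} {A} →
               Renames ρ ξ Γ Δ → Renames ρ (lift 1 ξ) (A ∷ Γ) (renF ρ A ∷ Δ)
Renames-lift r zero    = refl
Renames-lift r (suc x) = r x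

Renames-liftT : ∀ {n n′ m m′ ρ ξ} {Γ : Ctx² n m} {Δ : Ctx² n′ m′} → Renames ρ ξ Γ Δ →
                Renames (lift 1 ρ) ξ (map (renF suc) Γ) (map (renF suc) Δ)
Renames-liftT {ρ = ρ} {ξ} {Γ} {Δ} r x = begin
  lookup (map (renF suc) Δ) (ξ x)               ≡⟨ lookup-map (ξ x) _ Δ ⟩
  renF suc (lookup Δ (ξ x))                     ≡⟨ cong (renF suc) (r x) ⟩
  renF suc (renF ρ (lookup Γ x))                ≡⟨ renF-suc ρ (lookup Γ x) ⟨
  renF (lift 1 ρ) (renF suc (lookup Γ x))       ≡⟨ cong (renF (lift 1 ρ)) (lookup-map x _ Γ) ⟨
  renF (lift 1 ρ) (lookup (map (renF suc) Γ) x) ∎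
  where open ≡-Reasoning

ren²-⊢ : ∀ {n n′ m m′ ρ ξ} {Γ : Ctx² n m} {Δ : Ctx² n′ m′} {t A} → Renames ρ ξ Γ Δ →
         Γ ⊢ t ∶ A → Δ ⊢ ren² ρ ξ t ∶ renF ρ A
ren²-⊢ r (var x)                  = var-⊢ (r x)
ren²-⊢ {Γ = Γ} {Δ} r (ƛ d)        = ƛ (ren²-⊢ (Renames-lift {Γ = Γ} {Δ} r) d)
ren²-⊢ r (d · e)                  = ren²-⊢ r d · ren²-⊢ r e
ren²-⊢ {Γ = Γ} {Δ} r (Λ d)        = Λ (ren²-⊢ (Renames-liftT {Γ = Γ} {Δ} r) d)
ren²-⊢ {ρ = ρ} r (_∙_ {A = A} d Y) = ≡-⊢ (renF-inst ρ A Y) (ren²-⊢ r d ∙ ρ Y)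

Renames-id : ∀ {n m m′} {ξ : Fin m → Fin m′} {Γ : Ctx² n m} {Δ : Ctx² n m′} →
             (∀ x → lookup Δ (ξ x) ≡ lookup Γ x) → Renames id ξ Γ Δ
Renames-id r x = trans (r x) (sym (renF-id (λ _ → refl) _))

wk-⊢ : ∀ {n m} {Γ : Ctx² n m} {t A B} → Γ ⊢ t ∶ A → B ∷ Γ ⊢ wk t ∶ A
wk-⊢ {Γ = Γ} {B = B} d = ≡-⊢ (renF-id (λ _ → refl) _)
  (ren²-⊢ (Renames-id {ξ = suc} {Γ} {B ∷ Γ} (λ _ → refl)) d)

wkT-⊢ : ∀ {n m} {Γ : Ctx² n m} {t A} → Γ ⊢ t ∶ A → map (renF suc) Γ ⊢ wkT t ∶ renF suc A
wkT-⊢ {Γ = Γ} = ren²-⊢ (λ x → lookup-map x _ Γ)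

msub-⊢ : ∀ {n n′ m m′} {ρ : Fin n → Fin n′} {σ : Fin m → Term² n′ m′} {Γ : Ctx² n m}
         {Δ : Ctx² n′ m′} {t A} → (∀ x → Δ ⊢ σ x ∶ renF ρ (lookup Γ x)) →
         Γ ⊢ t ∶ A → Δ ⊢ msub ρ σ t ∶ renF ρ A
msub-⊢ s (var x) = s x
msub-⊢ s (ƛ d)   = ƛ (msub-⊢ (λ { zero → var zero ; (suc x) → wk-⊢ (s x) }) d)
msub-⊢ s (d · e) = msub-⊢ s d · msub-⊢ s e
msub-⊢ {ρ = ρ} {Γ = Γ} s (Λ d) = Λ (msub-⊢
  (λ x → ≡-⊢ (trans (sym (renF-suc ρ _)) (cong (renF (lift 1 ρ)) (sym (lookup-map x _ Γ)))) (wkT-⊢ (s x))) d)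
msub-⊢ {ρ = ρ} s (_∙_ {A = A} d Y) = ≡-⊢ (renF-inst ρ A Y) (msub-⊢ s d ∙ ρ Y)

sub²-⊢ : ∀ {n m m′} {σ : Fin m → Term² n m′} {Γ : Ctx² n m} {Δ : Ctx² n m′} {t A} →
         (∀ x → Δ ⊢ σ x ∶ lookup Γ x) → Γ ⊢ t ∶ A → Δ ⊢ sub² σ t ∶ A
sub²-⊢ {t = t} s d = subst₂ (_ ⊢_∶_) (sym (sub²≗msub (λ _ → refl) t)) (renF-id (λ _ → refl) _)
  (msub-⊢ (λ x → ≡-⊢ (sym (renF-id (λ _ → refl) _)) (s x)) d)

⟦⟧-⊢ : ∀ {n m} {Γ : Ctx² n m} {t s A B} → A ∷ Γ ⊢ t ∶ B → Γ ⊢ s ∶ A → Γ ⊢ t ⟦ s ⟧ ∶ B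
⟦⟧-⊢ d e = sub²-⊢ (λ { zero → e ; (suc x) → var x }) d

⟦⟧T-⊢ : ∀ {n m} {Γ : Ctx² n m} {t A} → map (renF suc) Γ ⊢ t ∶ A → ∀ Y → Γ ⊢ t ⟦ Y ⟧T ∶ A ⟦ Y ⟧F
⟦⟧T-⊢ {Γ = Γ} d Y = ren²-⊢
  (λ x → sym (trans (cong (renF (inst Y)) (lookup-map x _ Γ)) (renF-suc-inst (lookup Γ x) Y))) d

-- Through this lemma, typing of the constructs below is read off their
-- compatibility with conversion.
≃-⊢ : ∀ {n m} {Γ : Ctx² n m} {t u A} → Γ ⊢ t ≃ u ∶ A → Γ ⊢ t ∶ A × Γ ⊢ u ∶ A
≃-⊢ (reflexive d)    = d , d
≃-⊢ (symmetric d)    = proj₂ (≃-⊢ d) , proj₁ (≃-⊢ d)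
≃-⊢ (transitive d e) = proj₁ (≃-⊢ d) , proj₂ (≃-⊢ e)
≃-⊢ (ƛ-cong d)       = ƛ (proj₁ (≃-⊢ d)) , ƛ (proj₂ (≃-⊢ d))
≃-⊢ (·-cong d e)     = proj₁ (≃-⊢ d) · proj₁ (≃-⊢ e) , proj₂ (≃-⊢ d) · proj₂ (≃-⊢ e)
≃-⊢ (Λ-cong d)       = Λ (proj₁ (≃-⊢ d)) , Λ (proj₂ (≃-⊢ d))
≃-⊢ (∙-cong d Y)     = proj₁ (≃-⊢ d) ∙ Y , proj₂ (≃-⊢ d) ∙ Y
≃-⊢ (⊃β d e)         = ƛ d · e , ⟦⟧-⊢ d e
≃-⊢ (∀β d Y)         = Λ d ∙ Y , ⟦⟧T-⊢ d Y
≃-⊢ (⊃η d)           = ƛ (wk-⊢ d · var zero) , d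
≃-⊢ (∀η {A = A} d)   = Λ (≡-⊢ (renF-inst-suc A) (wkT-⊢ d ∙ zero)) , d

≃-⊢ˡ : ∀ {n m} {Γ : Ctx² n m} {t u A} → Γ ⊢ t ≃ u ∶ A → Γ ⊢ t ∶ A
≃-⊢ˡ d = proj₁ (≃-⊢ d)

ren²-⟦⟧ : ∀ {n n′ m m′} (ρ : Fin n → Fin n′) (ξ : Fin m → Fin m′) t s →
          ren² ρ (lift 1 ξ) t ⟦ ren² ρ ξ s ⟧ ≡ ren² ρ ξ (t ⟦ s ⟧)
ren²-⟦⟧ ρ ξ t s = begin
  ren² ρ (lift 1 ξ) t ⟦ ren² ρ ξ s ⟧
    ≡⟨ sub²≗msub (λ _ → refl) (ren² ρ (lift 1 ξ) t) ⟩
  msub id (ren² ρ ξ s F.∷ var) (ren² ρ (lift 1 ξ) t)  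
    ≡⟨ msub-ren²-swap (λ _ → refl) (λ { zero → refl ; (suc x) → refl }) t ⟩
  ren² ρ ξ (msub id (s F.∷ var) t)
    ≡⟨ cong (ren² ρ ξ) (sub²≗msub (λ _ → refl) t) ⟨
  ren² ρ ξ (t ⟦ s ⟧)                                     ∎
  where open ≡-Reasoning

ren²-≃ : ∀ {n n′ m m′ ρ ξ} {Γ : Ctx² n m} {Δ : Ctx² n′ m′} {t u A} → Renames ρ ξ Γ Δ →
         Γ ⊢ t ≃ u ∶ A → Δ ⊢ ren² ρ ξ t ≃ ren² ρ ξ u ∶ renF ρ A
ren²-≃ r (reflexive d)    = reflexive (ren²-⊢ r d)
ren²-≃ r (symmetric d)    = symmetric (ren²-≃ r d)
ren²-≃ r (transitive d e) = transitive (ren²-≃ r d) (ren²-≃ r e)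
ren²-≃ {Γ = Γ} {Δ} r (ƛ-cong d) = ƛ-cong (ren²-≃ (Renames-lift {Γ = Γ} {Δ} r) d)
ren²-≃ r (·-cong d e)     = ·-cong (ren²-≃ r d) (ren²-≃ r e)
ren²-≃ {Γ = Γ} {Δ} r (Λ-cong d) = Λ-cong (ren²-≃ (Renames-liftT {Γ = Γ} {Δ} r) d)
ren²-≃ {ρ = ρ} r (∙-cong {A = A} d Y) =
  ≡-≃-type (renF-inst ρ A Y) (∙-cong (ren²-≃ r d) (ρ Y))
ren²-≃ {ρ = ρ} {ξ} {Γ} {Δ} r (⊃β {t = t} {s} d e) = ≡-≃ refl (ren²-⟦⟧ ρ ξ t s)
  (⊃β (ren²-⊢ (Renames-lift {Γ = Γ} {Δ} r) d) (ren²-⊢ r e))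
ren²-≃ {ρ = ρ} {ξ} {Γ} {Δ} r (∀β {A = A} {t} d Y) =
  ≡-≃-type (renF-inst ρ A Y)
    (≡-≃ refl (ren²-square (inst-lift ρ Y) (λ _ → refl) t)
      (∀β (ren²-⊢ (Renames-liftT {Γ = Γ} {Δ} r) d) (ρ Y)))
ren²-≃ {ρ = ρ} r (⊃η {A = A} {t = t} d) =
  ≡-≃ (cong (λ w → ƛ (renF ρ A) (w · var zero)) (ren²-square (λ _ → refl) (λ _ → refl) t)) refl
    (⊃η (ren²-⊢ r d))
ren²-≃ r (∀η {t = t} d) =
  ≡-≃ (cong (λ w → Λ (w ∙ zero)) (ren²-square (λ _ → refl) (λ _ → refl) t)) refl
    (∀η (ren²-⊢ r d))

ren²-id-≃ : ∀ {n m m′} {ξ : Fin m → Fin m′} {Γ : Ctx² n m} {Δ : Ctx² n m′} {t u A} →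
            (∀ x → lookup Δ (ξ x) ≡ lookup Γ x) →
            Γ ⊢ t ≃ u ∶ A → Δ ⊢ ren² id ξ t ≃ ren² id ξ u ∶ A
ren²-id-≃ {Γ = Γ} {Δ} r d = ≡-≃-type (renF-id (λ _ → refl) _) (ren²-≃ (Renames-id {Γ = Γ} {Δ} r) d)

wk-≃ : ∀ {n m} {Γ : Ctx² n m} {t u A B} → Γ ⊢ t ≃ u ∶ A → B ∷ Γ ⊢ wk t ≃ wk u ∶ A
wk-≃ {Γ = Γ} {B = B} = ren²-id-≃ {ξ = suc} {Γ} {B ∷ Γ} (λ _ → refl)

wkT-≃ : ∀ {n m} {Γ : Ctx² n m} {t u A} → Γ ⊢ t ≃ u ∶ A →
        map (renF suc) Γ ⊢ wkT t ≃ wkT u ∶ renF suc A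
wkT-≃ {Γ = Γ} = ren²-≃ (λ x → lookup-map x _ Γ)

wk*-≃ : ∀ {n m p} {Γ : Ctx² n m} (As : Vec (Form² n) p) {t u A} → Γ ⊢ t ≃ u ∶ A →
        Γ ◁ As ⊢ ren² id (wk* p) t ≃ ren² id (wk* p) u ∶ A
wk*-≃ {Γ = Γ} As = ren²-id-≃ (lookup-◁-wk* Γ As)

lift*-≃ : ∀ {n m m′ p} {ξ : Fin m → Fin m′} {Γ : Ctx² n m} {Δ : Ctx² n m′}
          (As : Vec (Form² n) p) {t u A} → (∀ x → lookup Δ (ξ x) ≡ lookup Γ x) →
          Γ ◁ As ⊢ t ≃ u ∶ A → Δ ◁ As ⊢ ren² id (lift* p ξ) t ≃ ren² id (lift* p ξ) u ∶ A
lift*-≃ {p = p} {ξ} {Γ} {Δ} As r = ren²-id-≃ (⊕-elim p _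
  (λ x → trans (cong (lookup (Δ ◁ As)) (lift*-wk* p ξ x))
           (trans (lookup-◁-wk* Δ As (ξ x)) (trans (r x) (sym (lookup-◁-wk* Γ As x)))))
  (λ i → trans (cong (lookup (Δ ◁ As)) (lift*-bound² ξ i))
           (trans (lookup-◁-bound² Δ As i) (sym (lookup-◁-bound² Γ As i)))))

wkT-◁-≃ : ∀ {n m p} {Γ : Ctx² n m} (As : Vec (Form² n) p) {t u A} → Γ ◁ As ⊢ t ≃ u ∶ A →
          map (renF suc) Γ ◁ map (renF suc) As ⊢ wkT t ≃ wkT u ∶ renF suc A
wkT-◁-≃ {Γ = Γ} As d = subst (_⊢ _ ≃ _ ∶ _) (map-◁ (renF suc) Γ As) (wkT-≃ d)

-- Blocks of abstractions and applications.

·*-≃ : ∀ {n m p} {Γ : Ctx² n m} (As : Vec (Form² n) p) {t u B} {ts us : Vector (Term² n m) p} →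
       Γ ⊢ t ≃ u ∶ As ⊃* B → (∀ i → Γ ⊢ ts i ≃ us i ∶ lookup As i) → Γ ⊢ t ·* ts ≃ u ·* us ∶ B
·*-≃ []       d e = d
·*-≃ (A ∷ As) d e = ·*-≃ As (·-cong d (e zero)) (λ i → e (suc i))

ƛ*-≃ : ∀ {n m p} {Γ : Ctx² n m} (As : Vec (Form² n) p) {t u B} →
       Γ ◁ As ⊢ t ≃ u ∶ B → Γ ⊢ ƛ* As t ≃ ƛ* As u ∶ As ⊃* B
ƛ*-≃ []       d = d
ƛ*-≃ (A ∷ As) d = ƛ-cong (ƛ*-≃ As d)

-- Instantiating a block after its preceding variable amounts to instantiating
-- the longer block at once.
consS*-⟦⟧ : ∀ {n m p} (s : Term² n m) (us : Vector (Term² n m) p) t →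
            sub² (consS* var us) (sub² (liftS* p (s F.∷ var)) t) ≡ sub² (consS* (s F.∷ var) us) t
consS*-⟦⟧ {p = p} s us t = begin
  sub² (consS* var us) (sub² σ t)       ≡⟨ sub²≗msub (λ _ → refl) (sub² σ t) ⟩
  msub id (consS* var us) (sub² σ t)
    ≡⟨ cong (msub id (consS* var us)) (sub²≗msub (λ _ → refl) t) ⟩
  msub id (consS* var us) (msub id σ t) ≡⟨ msub-msub (λ _ → refl) (⊕-elim p _ old new) t ⟩
  msub id (consS* (s F.∷ var) us) t     ≡⟨ sub²≗msub (λ _ → refl) t ⟨
  sub² (consS* (s F.∷ var) us) t        ∎
  where
  open ≡-Reasoning
  σ = liftS* p (s F.∷ var)
  old : ∀ x → msub id (consS* var us) (σ (wk* p x)) ≡ consS* (s F.∷ var) us (wk* p x)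
  old x = begin
    msub id (consS* var us) (σ (wk* p x))
      ≡⟨ cong (msub id _) (liftS*-wk* p _ x) ⟩
    msub id (consS* var us) (ren² id (wk* p) ((s F.∷ var) x))
      ≡⟨ msub-ren² (λ _ → refl) (consS*-wk* var us) ((s F.∷ var) x) ⟩
    msub id var ((s F.∷ var) x)
      ≡⟨ msub-id (λ _ → refl) (λ _ → refl) ((s F.∷ var) x) ⟩
    (s F.∷ var) x                                                 ≡⟨ consS*-wk* _ us x ⟨
    consS* (s F.∷ var) us (wk* p x)                               ∎
  new : ∀ i → msub id (consS* var us) (σ (bound² i)) ≡ consS* (s F.∷ var) us (bound² i)
  new i = begin
    msub id (consS* var us) (σ (bound² i)) ≡⟨ cong (msub id _) (liftS*-bound² _ i) ⟩
    consS* var us (bound² i)               ≡⟨ consS*-bound² _ us i ⟩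
    us i                                   ≡⟨ consS*-bound² _ us i ⟨
    consS* (s F.∷ var) us (bound² i)       ∎

sub²-ƛ* : ∀ {n m m′ p} (σ : Fin m → Term² n m′) (As : Vec (Form² n) p) t →
          sub² σ (ƛ* As t) ≡ ƛ* As (sub² (liftS* p σ) t)
sub²-ƛ* σ []       t = refl
sub²-ƛ* σ (A ∷ As) t = cong (ƛ A) (sub²-ƛ* (liftS² σ) As t)

liftS*-⊢ : ∀ {n m m′ p} {σ : Fin m → Term² n m′} {Γ : Ctx² n m} {Δ : Ctx² n m′}
           (As : Vec (Form² n) p) → (∀ x → Δ ⊢ σ x ∶ lookup Γ x) →
           ∀ x → Δ ◁ As ⊢ liftS* p σ x ∶ lookup (Γ ◁ As) x
liftS*-⊢ []       s = s
liftS*-⊢ (A ∷ As) s = liftS*-⊢ As λ { zero → var zero ; (suc x) → wk-⊢ (s x) }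

ƛ*-β : ∀ {n m p} {Γ : Ctx² n m} (As : Vec (Form² n) p) {t B} {us : Vector (Term² n m) p} →
       Γ ◁ As ⊢ t ∶ B → (∀ i → Γ ⊢ us i ∶ lookup As i) →
       Γ ⊢ ƛ* As t ·* us ≃ sub² (consS* var us) t ∶ B
ƛ*-β [] {t} d e = ≡-≃ refl (sym (trans (sub²≗msub (λ _ → refl) t) (msub-id (λ _ → refl) (λ _ → refl) t)))
  (reflexive d)
ƛ*-β {p = suc p} {Γ} (A ∷ As) {t} {B} {us} d e = transitive
  (·*-≃ As {B = B} (≡-≃ refl (sub²-ƛ* (us zero F.∷ var) As t)
            (⊃β (≃-⊢ˡ (ƛ*-≃ As (reflexive d))) (e zero)))
           (λ i → reflexive (e (suc i))))
  (≡-≃ refl (consS*-⟦⟧ (us zero) (us ∘ suc) t)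
    (ƛ*-β As (sub²-⊢ (liftS*-⊢ {Γ = A ∷ Γ} As λ { zero → e zero ; (suc x) → var x }) d)
      (λ i → e (suc i))))

ƛ*-η : ∀ {n m p} {Γ : Ctx² n m} (As : Vec (Form² n) p) {t B} → Γ ⊢ t ∶ As ⊃* B →
       Γ ⊢ ƛ* As (ren² id (wk* p) t ·* (λ i → var (bound² {p = p} i))) ≃ t ∶ As ⊃* B
ƛ*-η {p = p} [] {t} d = ≡-≃ (sym (ren²-id (λ _ → refl) (λ _ → refl) t)) refl (reflexive d)
ƛ*-η {p = suc p} (A ∷ As) {t} d = transitive
  (≡-≃ (cong (λ w → ƛ A (ƛ* As ((w · var (wk* p zero)) ·* (λ i → var (bound² {p = p} i)))))
             (ren²-∘ (λ _ → refl) (λ _ → refl) t)) refl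
    (ƛ-cong (ƛ*-η As (wk-⊢ d · var zero))))
  (⊃η d)

-- Sums and case distinction in NI²at.

-- For a family Ps of lists of premise types, the types of the branches of a
-- case distinction whose target is the fresh type variable zero.
Clauses : ∀ {n K} {p : Fin K → ℕ} → (∀ k → Vec (Form² n) (p k)) → Vec (Form² (suc n)) K
Clauses Ps = tabulate (λ k → map (renF suc) (Ps k) ⊃* var zero)

-- The translation of a polynomial connective, depending only on the lists of
-- its premise types.
Sum : ∀ {n K} {p : Fin K → ℕ} → (∀ k → Vec (Form² n) (p k)) → Form² n
Sum Ps = ∀′ (Clauses Ps ⊃* var zero)

-- The ESF-translation of ι, for translated premises ts.
inj : ∀ {n m K} {p : Fin K → ℕ} (Ps : ∀ k → Vec (Form² n) (p k)) (k : Fin K) →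
      Vector (Term² n m) (p k) → Term² n m
inj {K = K} Ps k ts = Λ (ƛ* (Clauses Ps) (var (bound² k) ·* (λ i → ren² suc (wk* K) (ts i))))

-- The ESF-translation of δ at type B, by recursion on B: each fresh variable
-- of B is abstracted outside and fed to every branch inside.
case : ∀ {n m K} {p : Fin K → ℕ} (B : Form² n) → Term² n m → (∀ k → Vec (Form² n) (p k)) →
       (∀ k → Term² n (p k ⊕ m)) → Term² n m
case (var Z) t Ps ss = (t ∙ Z) ·* (λ k → ƛ* (Ps k) (ss k))
case {p = p} (C ⊃ D) t Ps ss =
  ƛ C (case D (wk t) Ps (λ k → ren² id (lift* (p k) suc) (ss k) · var (wk* (p k) zero)))
case (∀′ D) t Ps ss = Λ (case D (wkT t) (λ k → map (renF suc) (Ps k)) (λ k → wkT (ss k) ∙ zero))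

-- The types of the branches when the target is the variable Y.
ClausesAt : ∀ {n K} {p : Fin K → ℕ} → (∀ k → Vec (Form² n) (p k)) → Fin n → Vec (Form² n) K
ClausesAt Ps Y = tabulate (λ k → Ps k ⊃* var Y)

map-tabulate : ∀ {X Y : Set} {K} {h : X → Y} {f : Fin K → X} {g : Fin K → Y} →
               h ∘ f ≗ g → map h (tabulate f) ≡ tabulate g
map-tabulate {h = h} {f} e = trans (sym (tabulate-∘ h f)) (tabulate-cong e)

Clauses-renF : ∀ {n n′ K} {p : Fin K → ℕ} (ρ : Fin n → Fin n′) (Ps : ∀ k → Vec (Form² n) (p k)) →
               map (renF (lift 1 ρ)) (Clauses Ps) ≡ Clauses (λ k → map (renF ρ) (Ps k))
Clauses-renF ρ Ps = map-tabulate λ k →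
  trans (renF-⊃* (lift 1 ρ) (map (renF suc) (Ps k)) (var zero))
    (cong (_⊃* var zero) (map-renF-suc ρ (Ps k)))

renF-Sum : ∀ {n n′ K} {p : Fin K → ℕ} (ρ : Fin n → Fin n′) (Ps : ∀ k → Vec (Form² n) (p k)) →
           renF ρ (Sum Ps) ≡ Sum (λ k → map (renF ρ) (Ps k))
renF-Sum ρ Ps = cong ∀′ (trans (renF-⊃* (lift 1 ρ) (Clauses Ps) (var zero))
  (cong (_⊃* var zero) (Clauses-renF ρ Ps)))

Clauses-cong : ∀ {n K} {p : Fin K → ℕ} {Ps Qs : ∀ k → Vec (Form² n) (p k)} →
               (∀ k → Ps k ≡ Qs k) → Clauses Ps ≡ Clauses Qs
Clauses-cong e = tabulate-cong (λ k → cong (λ As → map (renF suc) As ⊃* var zero) (e k))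

Clauses-inst : ∀ {n K} {p : Fin K → ℕ} (Ps : ∀ k → Vec (Form² n) (p k)) Y →
               map (renF (inst Y)) (Clauses Ps) ≡ ClausesAt Ps Y
Clauses-inst Ps Y = map-tabulate λ k →
  trans (renF-⊃* (inst Y) (map (renF suc) (Ps k)) (var zero))
    (cong (_⊃* var Y) (trans (sym (map-∘ _ _ (Ps k))) (map-id′ (λ A → renF-suc-inst A Y) (Ps k))))

Sum-inst : ∀ {n K} {p : Fin K → ℕ} (Ps : ∀ k → Vec (Form² n) (p k)) Y →
           (Clauses Ps ⊃* var zero) ⟦ Y ⟧F ≡ ClausesAt Ps Y ⊃* var Y
Sum-inst Ps Y = trans (renF-⊃* (inst Y) (Clauses Ps) (var zero)) (cong (_⊃* var Y) (Clauses-inst Ps Y))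

case-cong : ∀ {n m K} {p : Fin K → ℕ} {B B′ : Form² n} {t t′ : Term² n m}
            {Ps Qs : ∀ k → Vec (Form² n) (p k)} {ss rs : ∀ k → Term² n (p k ⊕ m)} →
            B ≡ B′ → t ≡ t′ → (∀ k → Ps k ≡ Qs k) → (∀ k → ss k ≡ rs k) →
            case B t Ps ss ≡ case B′ t′ Qs rs
case-cong {B = var Z} refl refl e f = ·*-cong refl (λ k → cong₂ ƛ* (e k) (f k))
case-cong {p = p} {B = C ⊃ D} refl refl e f = cong (ƛ C) (case-cong {B = D} refl refl e
  (λ k → cong (λ s → ren² id (lift* (p k) suc) s · var (wk* (p k) zero)) (f k)))
case-cong {B = ∀′ D} refl refl e f = cong Λ (case-cong {B = D} refl refl
  (λ k → cong (map (renF suc)) (e k)) (λ k → cong (λ s → wkT s ∙ zero) (f k)))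

case-msub : ∀ {n n′ m m′ K} {p : Fin K → ℕ} (ρ : Fin n → Fin n′) (σ : Fin m → Term² n′ m′) B t
            (Ps : ∀ k → Vec (Form² n) (p k)) (ss : ∀ k → Term² n (p k ⊕ m)) →
            msub ρ σ (case B t Ps ss) ≡
            case (renF ρ B) (msub ρ σ t) (λ k → map (renF ρ) (Ps k))
              (λ k → msub ρ (liftS* (p k) σ) (ss k))
case-msub ρ σ (var Z) t Ps ss = trans (msub-·* ρ σ (t ∙ Z) (λ k → ƛ* (Ps k) (ss k)))
  (·*-cong refl (λ k → msub-ƛ* ρ σ (Ps k) (ss k)))
case-msub {p = p} ρ σ (C ⊃ D) t Ps ss = cong (ƛ (renF ρ C)) (trans
  (case-msub ρ (liftS² σ) D (wk t) Ps (λ k → ren² id (lift* (p k) suc) (ss k) · var (wk* (p k) zero)))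
  (case-cong {B = renF ρ D} refl (msub-ren²-swap (λ _ → refl) (λ _ → refl) t) (λ _ → refl)
    (λ k → cong₂ _·_ (msub-ren²-swap (λ _ → refl) (liftS*-ren² (p k) (λ _ → refl)) (ss k))
                     (liftS*-wk* (p k) (liftS² σ) zero))))
case-msub {p = p} ρ σ (∀′ D) t Ps ss = cong Λ (trans
  (case-msub (lift 1 ρ) (wkT ∘ σ) D (wkT t) (λ k → map (renF suc) (Ps k)) (λ k → wkT (ss k) ∙ zero))
  (case-cong {B = renF (lift 1 ρ) D} refl (msub-ren²-swap (λ _ → refl) (λ _ → refl) t)
    (λ k → map-renF-suc ρ (Ps k))
    (λ k → cong (_∙ zero) (msub-ren²-swap (λ _ → refl)
      (λ x → trans (cong (liftS* (p k) (wkT ∘ σ)) (sym (lift*-id (p k) x)))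
        (trans (liftS*-ren² (p k) (λ _ → refl) x)
          (ren²-cong (λ _ → refl) (lift*-id (p k)) _))) (ss k)))))

case-ren² : ∀ {n n′ m m′ K} {p : Fin K → ℕ} (ρ : Fin n → Fin n′) (ξ : Fin m → Fin m′) B t
            (Ps : ∀ k → Vec (Form² n) (p k)) (ss : ∀ k → Term² n (p k ⊕ m)) →
            ren² ρ ξ (case B t Ps ss) ≡
            case (renF ρ B) (ren² ρ ξ t) (λ k → map (renF ρ) (Ps k))
              (λ k → ren² ρ (lift* (p k) ξ) (ss k))
case-ren² {p = p} ρ ξ B t Ps ss = trans (ren²≗msub (λ _ → refl) (case B t Ps ss))
  (trans (case-msub ρ (var ∘ ξ) B t Ps ss)
    (case-cong {B = renF ρ B} refl (sym (ren²≗msub (λ _ → refl) t)) (λ _ → refl)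
      (λ k → sym (ren²≗msub (λ x → sym (liftS*-var (p k) ξ x)) (ss k)))))

case-ren²-id : ∀ {n m m′ K} {p : Fin K → ℕ} (ξ : Fin m → Fin m′) B t
               (Ps : ∀ k → Vec (Form² n) (p k)) (ss : ∀ k → Term² n (p k ⊕ m)) →
               ren² id ξ (case B t Ps ss) ≡
               case B (ren² id ξ t) Ps (λ k → ren² id (lift* (p k) ξ) (ss k))
case-ren²-id ξ B t Ps ss = trans (case-ren² id ξ B t Ps ss)
  (case-cong (renF-id (λ _ → refl) B) refl (λ k → map-renF-id (Ps k)) (λ _ → refl))

case-sub² : ∀ {n m m′ K} {p : Fin K → ℕ} (σ : Fin m → Term² n m′) B t
            (Ps : ∀ k → Vec (Form² n) (p k)) (ss : ∀ k → Term² n (p k ⊕ m)) →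
            sub² σ (case B t Ps ss) ≡
            case B (sub² σ t) Ps (λ k → sub² (liftS* (p k) σ) (ss k))
case-sub² σ B t Ps ss = trans (sub²≗msub (λ _ → refl) (case B t Ps ss))
  (trans (case-msub id σ B t Ps ss)
    (case-cong (renF-id (λ _ → refl) B) (sym (sub²≗msub (λ _ → refl) t)) (λ k → map-renF-id (Ps k))
      (λ k → sym (sub²≗msub (λ _ → refl) (ss k)))))

inj-msub : ∀ {n n′ m m′ K} {p : Fin K → ℕ} (ρ : Fin n → Fin n′) (σ : Fin m → Term² n′ m′)
           (Ps : ∀ k → Vec (Form² n) (p k)) k ts →
           msub ρ σ (inj Ps k ts) ≡ inj (λ k → map (renF ρ) (Ps k)) k (msub ρ σ ∘ ts)
inj-msub {K = K} {p} ρ σ Ps k ts = cong Λ (trans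
  (msub-ƛ* (lift 1 ρ) (wkT ∘ σ) (Clauses Ps) _)
  (cong₂ ƛ*
    (Clauses-renF ρ Ps)
    (trans (msub-·* {p = p k} (lift 1 ρ) (liftS* K (wkT ∘ σ)) (var (bound² k)) _)
      (·*-cong {p = p k} (liftS*-bound² _ k)
        (λ i → msub-ren²-swap (λ _ → refl)
          (λ x → trans (liftS*-wk* K _ x) (ren²-∘ (λ _ → refl) (λ _ → refl) (σ x))) (ts i))))))

inj-cong : ∀ {n m K} {p : Fin K → ℕ} {Ps Qs : ∀ k → Vec (Form² n) (p k)} k
           {ts us : Vector (Term² n m) (p k)} →
           (∀ k → Ps k ≡ Qs k) → ts ≗ us → inj Ps k ts ≡ inj Qs k us
inj-cong {p = p} {Ps} {Qs} k e f = 
  cong Λ (cong₂ ƛ* (Clauses-cong {Ps = Ps} {Qs} e)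
    (·*-cong {p = p k} refl (λ i → cong (ren² _ _) (f i))))

inj-ren² : ∀ {n n′ m m′ K} {p : Fin K → ℕ} (ρ : Fin n → Fin n′) (ξ : Fin m → Fin m′)
           (Ps : ∀ k → Vec (Form² n) (p k)) k ts →
           ren² ρ ξ (inj Ps k ts) ≡ inj (λ k → map (renF ρ) (Ps k)) k (ren² ρ ξ ∘ ts)
inj-ren² ρ ξ Ps k ts = trans (ren²≗msub (λ _ → refl) (inj Ps k ts))
  (trans (inj-msub ρ (var ∘ ξ) Ps k ts)
    (inj-cong {Ps = λ k → map (renF ρ) (Ps k)} k (λ _ → refl) (λ i → sym (ren²≗msub (λ _ → refl) (ts i)))))

-- Compatibility with conversion.

Sum-elim-≃ : ∀ {n m K} {p : Fin K → ℕ} {Γ : Ctx² n m} (Ps : ∀ k → Vec (Form² n) (p k)) Y {t t′}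
             {us us′ : Vector (Term² n m) K} → Γ ⊢ t ≃ t′ ∶ Sum Ps →
             (∀ k → Γ ⊢ us k ≃ us′ k ∶ Ps k ⊃* var Y) →
             Γ ⊢ (t ∙ Y) ·* us ≃ (t′ ∙ Y) ·* us′ ∶ var Y
Sum-elim-≃ Ps Y d e = ·*-≃ (ClausesAt Ps Y) (≡-≃-type (Sum-inst Ps Y) (∙-cong d Y))
  (λ k → ≡-≃-type (sym (lookup∘tabulate _ k)) (e k))

inj-body-≃ : ∀ {n m K} {p : Fin K → ℕ} {Γ : Ctx² n m} (Ps : ∀ k → Vec (Form² n) (p k)) k
             {ts us : Vector (Term² n m) (p k)} → (∀ i → Γ ⊢ ts i ≃ us i ∶ lookup (Ps k) i) →
             map (renF suc) Γ ◁ Clauses Ps ⊢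
               var (bound² k) ·* (λ i → ren² suc (wk* K) (ts i)) ≃
               var (bound² k) ·* (λ i → ren² suc (wk* K) (us i)) ∶ var zero
inj-body-≃ {Γ = Γ} Ps k e = ·*-≃ (map (renF suc) (Ps k))
  (reflexive (var-⊢ (trans (lookup-◁-bound² _ (Clauses Ps) k) (lookup∘tabulate _ k))))
  (λ i → ≡-≃-type (sym (lookup-map i _ (Ps k)))
    (ren²-≃ (λ x → trans (lookup-◁-wk* _ (Clauses Ps) x) (lookup-map x _ Γ)) (e i)))

inj-≃ : ∀ {n m K} {p : Fin K → ℕ} {Γ : Ctx² n m} (Ps : ∀ k → Vec (Form² n) (p k)) k
        {ts us : Vector (Term² n m) (p k)} → (∀ i → Γ ⊢ ts i ≃ us i ∶ lookup (Ps k) i) →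
        Γ ⊢ inj Ps k ts ≃ inj Ps k us ∶ Sum Ps
inj-≃ Ps k e = Λ-cong (ƛ*-≃ (Clauses Ps) (inj-body-≃ Ps k e))

-- The branches that case passes to its recursive call, at B = C ⊃ D and at
-- B = ∀′ D.
branch-⊃-≃ : ∀ {n m p} {Γ : Ctx² n m} (As : Vec (Form² n) p) {s r C D} →
             Γ ◁ As ⊢ s ≃ r ∶ C ⊃ D →
             (C ∷ Γ) ◁ As ⊢ ren² id (lift* p suc) s · var (wk* p zero) ≃
                            ren² id (lift* p suc) r · var (wk* p zero) ∶ D
branch-⊃-≃ {Γ = Γ} As {C = C} d = ·-cong (lift*-≃ {Γ = Γ} {C ∷ Γ} As (λ _ → refl) d)
  (reflexive (var-⊢ (lookup-◁-wk* (C ∷ Γ) As zero)))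

branch-∀-≃ : ∀ {n m p} {Γ : Ctx² n m} (As : Vec (Form² n) p) {s r D} →
             Γ ◁ As ⊢ s ≃ r ∶ ∀′ D →
             map (renF suc) Γ ◁ map (renF suc) As ⊢ wkT s ∙ zero ≃ wkT r ∙ zero ∶ D
branch-∀-≃ As {D = D} d = ≡-≃-type (renF-inst-suc D) (∙-cong (wkT-◁-≃ As d) zero)

case-≃ : ∀ {n m K} {p : Fin K → ℕ} {Γ : Ctx² n m} B {t t′} (Ps : ∀ k → Vec (Form² n) (p k)) {ss rs} →
         Γ ⊢ t ≃ t′ ∶ Sum Ps → (∀ k → Γ ◁ Ps k ⊢ ss k ≃ rs k ∶ B) →
         Γ ⊢ case B t Ps ss ≃ case B t′ Ps rs ∶ B
case-≃ (var Z) Ps d e = Sum-elim-≃ Ps Z d (λ k → ƛ*-≃ (Ps k) (e k))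
case-≃ (C ⊃ D) Ps d e = ƛ-cong (case-≃ D Ps (wk-≃ d) (λ k → branch-⊃-≃ (Ps k) (e k)))
case-≃ (∀′ D)  Ps d e = Λ-cong (case-≃ D (λ k → map (renF suc) (Ps k))
  (≡-≃-type (renF-Sum suc Ps) (wkT-≃ d)) (λ k → branch-∀-≃ (Ps k) (e k)))

-- β-reduction for sums.

inj-β : ∀ {n m K} {p : Fin K → ℕ} {Γ : Ctx² n m} (Ps : ∀ k → Vec (Form² n) (p k)) Y k
        {ts : Vector (Term² n m) (p k)} {us : Vector (Term² n m) K} →
        (∀ i → Γ ⊢ ts i ∶ lookup (Ps k) i) → (∀ l → Γ ⊢ us l ∶ Ps l ⊃* var Y) →
        Γ ⊢ (inj Ps k ts ∙ Y) ·* us ≃ us k ·* ts ∶ var Y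
inj-β {K = K} {p} {Γ} Ps Y k {ts} {us} d e = transitive
  (·*-≃ (ClausesAt Ps Y)
    (≡-≃-type (Sum-inst Ps Y) (≡-≃ refl inst-inj
      (∀β (≃-⊢ˡ (ƛ*-≃ (Clauses Ps) (inj-body-≃ Ps k (λ i → reflexive (d i))))) Y)))
    (λ l → ≡-≃-type (sym (lookup∘tabulate _ l)) (reflexive (e l))))
  (≡-≃ refl sub-body (ƛ*-β (ClausesAt Ps Y) body-⊢ (λ l → ≡-⊢ (sym (lookup∘tabulate _ l)) (e l))))
  where
  body = var (bound² k) ·* (λ i → ren² id (wk* K) (ts i))
  body-⊢ : Γ ◁ ClausesAt Ps Y ⊢ body ∶ var Y
  body-⊢ = ≃-⊢ˡ (·*-≃ (Ps k)
    (reflexive (var-⊢ (trans (lookup-◁-bound² Γ (ClausesAt Ps Y) k) (lookup∘tabulate _ k))))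
    (λ i → wk*-≃ (ClausesAt Ps Y) (reflexive (d i))))
  inst-inj : ƛ* (Clauses Ps) (var (bound² k) ·* (λ i → ren² suc (wk* K) (ts i))) ⟦ Y ⟧T ≡
             ƛ* (ClausesAt Ps Y) body
  inst-inj = trans (ren²-ƛ* (inst Y) id (Clauses Ps) _) (cong₂ ƛ* (Clauses-inst Ps Y)
    (trans (ren²-·* {p = p k} (inst Y) (lift* K id) (var (bound² k)) _)
      (·*-cong {p = p k} (cong var (lift*-bound² id k))
        (λ i → ren²-∘ (λ _ → refl) (lift*-wk* K id) (ts i)))))
  sub-body : sub² (consS* var us) body ≡ us k ·* ts
  sub-body = trans (sub²≗msub (λ _ → refl) body)
    (trans (msub-·* {p = p k} id (consS* var us) (var (bound² k)) _)
      (·*-cong {p = p k} (consS*-bound² var us k)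
        (λ i → trans (msub-ren² (λ _ → refl) (consS*-wk* var us) (ts i))
                     (msub-id (λ _ → refl) (λ _ → refl) (ts i)))))

case-⊢ : ∀ {n m K} {p : Fin K → ℕ} {Γ : Ctx² n m} B {t} (Ps : ∀ k → Vec (Form² n) (p k)) {ss} →
         Γ ⊢ t ∶ Sum Ps → (∀ k → Γ ◁ Ps k ⊢ ss k ∶ B) → Γ ⊢ case B t Ps ss ∶ B
case-⊢ B Ps d e = ≃-⊢ˡ (case-≃ B Ps (reflexive d) (λ k → reflexive (e k)))

consS*-⊢ : ∀ {n m m′ p} {σ : Fin m → Term² n m′} {Γ : Ctx² n m} {Δ : Ctx² n m′}
           (As : Vec (Form² n) p) {us : Vector (Term² n m′) p} →
           (∀ x → Δ ⊢ σ x ∶ lookup Γ x) → (∀ i → Δ ⊢ us i ∶ lookup As i) →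
           ∀ x → Δ ⊢ consS* σ us x ∶ lookup (Γ ◁ As) x
consS*-⊢ []       s e = s
consS*-⊢ (A ∷ As) s e = consS*-⊢ As (λ { zero → e zero ; (suc x) → s x }) (λ i → e (suc i))

-- The map ζ is kept apart from lift* p ξ because wkT renames term variables by
-- id, which agrees with lift* p id only pointwise.
ren²-consS* : ∀ {n n′ m m′ p} (ρ : Fin n → Fin n′) (ξ : Fin m → Fin m′) {ζ : Fin (p ⊕ m) → Fin (p ⊕ m′)}
              (ts : Vector (Term² n m) p) s → ζ ≗ lift* p ξ →
              sub² (consS* var (ren² ρ ξ ∘ ts)) (ren² ρ ζ s) ≡ ren² ρ ξ (sub² (consS* var ts) s)
ren²-consS* {p = p} ρ ξ {ζ} ts s e = begin
  sub² (consS* var us) (ren² ρ ζ s)    ≡⟨ sub²≗msub (λ _ → refl) (ren² ρ ζ s) ⟩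
  msub id (consS* var us) (ren² ρ ζ s)
    ≡⟨ msub-ren²-swap (λ _ → refl)
         (λ x → trans (cong (consS* var us) (e x)) (⊕-elim p _ old new x)) s ⟩
  ren² ρ ξ (msub id (consS* var ts) s) ≡⟨ cong (ren² ρ ξ) (sub²≗msub (λ _ → refl) s) ⟨
  ren² ρ ξ (sub² (consS* var ts) s)    ∎
  where
  open ≡-Reasoning
  us = ren² ρ ξ ∘ ts
  old : ∀ x → consS* var us (lift* p ξ (wk* p x)) ≡ ren² ρ ξ (consS* var ts (wk* p x))
  old x = trans (cong (consS* var us) (lift*-wk* p ξ x))
    (trans (consS*-wk* var us (ξ x)) (cong (ren² ρ ξ) (sym (consS*-wk* var ts x))))
  new : ∀ i → consS* var us (lift* p ξ (bound² i)) ≡ ren² ρ ξ (consS* var ts (bound² i))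
  new i = trans (cong (consS* var us) (lift*-bound² ξ i))
    (trans (consS*-bound² var us i) (cong (ren² ρ ξ) (sym (consS*-bound² var ts i))))

case-β : ∀ {n m K} {p : Fin K → ℕ} {Γ : Ctx² n m} B (Ps : ∀ k → Vec (Form² n) (p k)) h
         {ts : Vector (Term² n m) (p h)} {ss} →
         (∀ i → Γ ⊢ ts i ∶ lookup (Ps h) i) → (∀ k → Γ ◁ Ps k ⊢ ss k ∶ B) →
         Γ ⊢ case B (inj Ps h ts) Ps ss ≃ sub² (consS* var ts) (ss h) ∶ B
case-β (var Z) Ps h d e = transitive
  (inj-β Ps Z h d (λ l → ≃-⊢ˡ (ƛ*-≃ (Ps l) (reflexive (e l)))))
  (ƛ*-β (Ps h) (e h) d)
case-β {p = p} {Γ} (C ⊃ D) Ps h {ts} {ss} d e = transitive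
  (ƛ-cong (≡-≃
    (case-cong {B = D} refl (sym (trans (inj-ren² id suc Ps h ts)
      (inj-cong {Qs = Ps} h (λ k → map-renF-id (Ps k)) (λ _ → refl)))) (λ _ → refl) (λ _ → refl))
    (cong₂ _·_ (ren²-consS* id suc ts (ss h) (λ _ → refl)) (consS*-wk* var (wk ∘ ts) zero))
    (case-β {Γ = C ∷ Γ} D Ps h (λ i → wk-⊢ (d i))
      (λ k → ≃-⊢ˡ (branch-⊃-≃ {Γ = Γ} (Ps k) (reflexive (e k)))))))
  (⊃η (sub²-⊢ (consS*-⊢ {Γ = Γ} (Ps h) var d) (e h)))
case-β {p = p} {Γ} (∀′ D) Ps h {ts} {ss} d e = transitive
  (Λ-cong (≡-≃
    (case-cong {B = D} refl (sym (inj-ren² suc id Ps h ts)) (λ _ → refl) (λ _ → refl))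
    (cong (_∙ zero) (ren²-consS* suc id ts (ss h) (λ x → sym (lift*-id (p h) x))))
    (case-β D (λ k → map (renF suc) (Ps k)) h
      (λ i → ≡-⊢ (sym (lookup-map i _ (Ps h))) (wkT-⊢ (d i)))
      (λ k → ≃-⊢ˡ (branch-∀-≃ {Γ = Γ} (Ps k) (reflexive (e k)))))))
  (∀η (sub²-⊢ (consS*-⊢ {Γ = Γ} (Ps h) var d) (e h)))

-- Commuting conversions for case.

wk-⟦⟧ : ∀ {n m} (t u : Term² n m) → wk t ⟦ u ⟧ ≡ t
wk-⟦⟧ t u = trans (sub²≗msub (λ _ → refl) (wk t))
  (trans (msub-ren² (λ _ → refl) (λ _ → refl) t) (msub-id (λ _ → refl) (λ _ → refl) t))

liftS*-⟦⟧ : ∀ {n m} p (u : Term² n m) s →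
            sub² (liftS* p (u F.∷ var)) (ren² id (lift* p suc) s) ≡ s
liftS*-⟦⟧ p u s = trans (sub²≗msub (λ _ → refl) (ren² id (lift* p suc) s))
  (trans (msub-ren² (λ _ → refl)
    (⊕-elim p _
      (λ x → trans (cong (liftS* p (u F.∷ var)) (lift*-wk* p suc x)) (liftS*-wk* p (u F.∷ var) (suc x)))
      (λ i → trans (cong (liftS* p (u F.∷ var)) (lift*-bound² suc i)) (liftS*-bound² {p = p} (u F.∷ var) i)))
    s)
  (msub-id (λ _ → refl) (λ _ → refl) s))

-- An argument, or a type argument, is moved into the branches by one β-step.
γ-· : ∀ {n m K} {p : Fin K → ℕ} {Γ : Ctx² n m} (Ps : ∀ k → Vec (Form² n) (p k)) {t u A B ss} →
      Γ ⊢ t ∶ Sum Ps → (∀ k → Γ ◁ Ps k ⊢ ss k ∶ A ⊃ B) → Γ ⊢ u ∶ A →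
      Γ ⊢ case (A ⊃ B) t Ps ss · u ≃ case B t Ps (λ k → ss k · ren² id (wk* (p k)) u) ∶ B
γ-· {p = p} {Γ} Ps {t} {u} {A} {B} {ss} d e f = ≡-≃ refl
  (trans (case-sub² (u F.∷ var) B (wk t) Ps _)
    (case-cong {B = B} refl (wk-⟦⟧ t u) (λ _ → refl)
      (λ k → cong₂ _·_ (liftS*-⟦⟧ (p k) u (ss k)) (liftS*-wk* (p k) (u F.∷ var) zero))))
  (⊃β (case-⊢ B Ps (wk-⊢ d) (λ k → ≃-⊢ˡ (branch-⊃-≃ {Γ = Γ} (Ps k) (reflexive (e k))))) f)

γ-∙ : ∀ {n m K} {p : Fin K → ℕ} {Γ : Ctx² n m} (Ps : ∀ k → Vec (Form² n) (p k)) Y {t A B ss} →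
      A ⟦ Y ⟧F ≡ B → Γ ⊢ t ∶ Sum Ps → (∀ k → Γ ◁ Ps k ⊢ ss k ∶ ∀′ A) →
      Γ ⊢ case (∀′ A) t Ps ss ∙ Y ≃ case B t Ps (λ k → ss k ∙ Y) ∶ B
γ-∙ {p = p} {Γ} Ps Y {t} {A} {ss = ss} refl d e = ≡-≃ refl
  (trans (case-ren² (inst Y) id A (wkT t) (λ k → map (renF suc) (Ps k)) _)
    (case-cong {B = A ⟦ Y ⟧F} refl (wkT-inst (λ _ → refl) t)
      (λ k → trans (map-fuse (λ _ → refl) (Ps k)) (map-id′ (λ C → renF-suc-inst C Y) (Ps k)))
      (λ k → cong (_∙ Y) (wkT-inst (lift*-id (p k)) (ss k)))))
  (∀β (case-⊢ A (λ k → map (renF suc) (Ps k)) (≡-⊢ (renF-Sum suc Ps) (wkT-⊢ d))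
        (λ k → ≃-⊢ˡ (branch-∀-≃ {Γ = Γ} (Ps k) (reflexive (e k))))) Y)
  where
  wkT-inst : ∀ {m} {ξ : Fin m → Fin m} → ξ ≗ id → ∀ s → ren² (inst Y) ξ (wkT s) ≡ s
  wkT-inst e s = trans (ren²-∘ (λ _ → refl) e s) (ren²-id (λ _ → refl) (λ _ → refl) s)

γ-·* : ∀ {n m K q} {p : Fin K → ℕ} {Γ : Ctx² n m} (Ps : ∀ k → Vec (Form² n) (p k))
       (As : Vec (Form² n) q) {t B ss} {us : Vector (Term² n m) q} →
       Γ ⊢ t ∶ Sum Ps → (∀ k → Γ ◁ Ps k ⊢ ss k ∶ As ⊃* B) → (∀ i → Γ ⊢ us i ∶ lookup As i) →
       Γ ⊢ case (As ⊃* B) t Ps ss ·* us ≃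
           case B t Ps (λ k → ss k ·* (λ i → ren² id (wk* (p k)) (us i))) ∶ B
γ-·* Ps []       {B = B} d e f = reflexive (case-⊢ B Ps d e)
γ-·* Ps (A ∷ As) {B = B} d e f = transitive
  (·*-≃ As {B = B} (γ-· Ps d e (f zero)) (λ i → reflexive (f (suc i))))
  (γ-·* Ps As d (λ k → e k · ≃-⊢ˡ (wk*-≃ (Ps k) (reflexive (f zero)))) (λ i → f (suc i)))

γ-Sum-elim : ∀ {n m K L} {p : Fin K → ℕ} {q : Fin L → ℕ} {Γ : Ctx² n m}
             (Ps : ∀ k → Vec (Form² n) (p k)) (Qs : ∀ l → Vec (Form² n) (q l)) Z {t ss}
             {us : Vector (Term² n m) L} →
             Γ ⊢ t ∶ Sum Ps → (∀ k → Γ ◁ Ps k ⊢ ss k ∶ Sum Qs) →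
             (∀ l → Γ ⊢ us l ∶ Qs l ⊃* var Z) →
             Γ ⊢ (case (Sum Qs) t Ps ss ∙ Z) ·* us ≃
                 case (var Z) t Ps (λ k → (ss k ∙ Z) ·* (λ l → ren² id (wk* (p k)) (us l))) ∶ var Z
γ-Sum-elim Ps Qs Z d e f = transitive
  (·*-≃ (ClausesAt Qs Z) (γ-∙ Ps Z (Sum-inst Qs Z) d e) (λ l → reflexive (f′ l)))
  (γ-·* Ps (ClausesAt Qs Z) d (λ k → ≡-⊢ (Sum-inst Qs Z) (e k ∙ Z)) f′)
  where
  f′ = λ l → ≡-⊢ (sym (lookup∘tabulate (λ l → Qs l ⊃* var Z) l)) (f l)

-- The outer case is unfolded on both sides.  On the right this leaves, in the
-- branch k, an application of case C (ss k) Qs to a fresh variable, which γ-·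
-- or γ-∙ turns back into a case at the smaller type.
γ-case : ∀ {n m K L} {p : Fin K → ℕ} {q : Fin L → ℕ} {Γ : Ctx² n m} C
         (Ps : ∀ k → Vec (Form² n) (p k)) (Qs : ∀ l → Vec (Form² n) (q l)) {t ss}
         {rs : ∀ l → Term² n (q l ⊕ m)} →
         Γ ⊢ t ∶ Sum Ps → (∀ k → Γ ◁ Ps k ⊢ ss k ∶ Sum Qs) → (∀ l → Γ ◁ Qs l ⊢ rs l ∶ C) →
         Γ ⊢ case C (case (Sum Qs) t Ps ss) Qs rs ≃
             case C t Ps (λ k → case C (ss k) Qs (λ l → ren² id (lift* (q l) (wk* (p k))) (rs l))) ∶ C
γ-case {p = p} {q} {Γ} (var Z) Ps Qs {t} {ss} {rs} d e f = ≡-≃ refl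
  (case-cong {B = var Z} refl refl (λ _ → refl) (λ k → ·*-cong refl (λ l →
    trans (ren²-ƛ* id (wk* (p k)) (Qs l) (rs l))
      (cong (λ As → ƛ* As (ren² id (lift* (q l) (wk* (p k))) (rs l))) (map-renF-id (Qs l))))))
  (γ-Sum-elim Ps Qs Z d e (λ l → ≃-⊢ˡ (ƛ*-≃ (Qs l) (reflexive (f l)))))
γ-case {n} {m} {p = p} {q} {Γ} (E ⊃ F) Ps Qs {t} {ss} {rs} d e f = ƛ-cong (transitive
  (≡-≃ (case-cong {B = F} refl (sym (case-ren²-id suc (Sum Qs) t Ps ss)) (λ _ → refl) (λ _ → refl)) refl
    (γ-case F Ps Qs (wk-⊢ d) ss-⊢ (λ l → ≃-⊢ˡ (branch-⊃-≃ {Γ = Γ} (Qs l) (reflexive (f l))))))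
  (case-≃ F Ps (reflexive (wk-⊢ d)) (λ k → symmetric (≡-≃
    (cong (_· var (wk* (p k) zero)) (sym (case-ren²-id (lift* (p k) suc) (E ⊃ F) (ss k) Qs (rs′ k))))
    (case-cong {B = F} refl refl (λ _ → refl) (λ l → cong₂ _·_
      (rs-square k l) (cong var (sym (lift*-wk* (q l) (wk* (p k)) zero)))))
    (γ-· Qs (ss-⊢ k) (rs-⊢ k) (var-⊢ (lookup-◁-wk* (E ∷ Γ) (Ps k) zero)))))))
  where
  rs′ : ∀ k l → Term² n (q l ⊕ (p k ⊕ m))
  rs′ k l = ren² id (lift* (q l) (wk* (p k))) (rs l)
  rs″ : ∀ k l → Term² n (q l ⊕ (p k ⊕ suc m))
  rs″ k l = ren² id (lift* (q l) (lift* (p k) suc)) (rs′ k l)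
  rs-square : ∀ k l → rs″ k l ≡ ren² id (lift* (q l) (wk* (p k))) (ren² id (lift* (q l) suc) (rs l))
  rs-square k l = ren²-square (λ _ → refl) (lift*-square (q l) (lift*-wk* (p k) suc)) (rs l)
  ss-⊢ : ∀ k → (E ∷ Γ) ◁ Ps k ⊢ ren² id (lift* (p k) suc) (ss k) ∶ Sum Qs
  ss-⊢ k = ≃-⊢ˡ (lift*-≃ {Γ = Γ} {E ∷ Γ} (Ps k) (λ _ → refl) (reflexive (e k)))
  rs-⊢ : ∀ k l → ((E ∷ Γ) ◁ Ps k) ◁ Qs l ⊢ rs″ k l ∶ E ⊃ F
  rs-⊢ k l = subst (_ ⊢_∶ _) (sym (rs-square k l))
    (≃-⊢ˡ (lift*-≃ (Qs l) (lookup-◁-wk* (E ∷ Γ) (Ps k))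
      (lift*-≃ {Γ = Γ} {E ∷ Γ} (Qs l) (λ _ → refl) (reflexive (f l)))))
γ-case {n} {m} {p = p} {q} {Γ} (∀′ F) Ps Qs {t} {ss} {rs} d e f = Λ-cong (transitive
  (≡-≃ (case-cong {B = F} refl
         (sym (trans (case-ren² suc id (Sum Qs) t Ps ss)
           (case-cong (renF-Sum suc Qs) refl (λ _ → refl)
             (λ k → ren²-cong (λ _ → refl) (lift*-id (p k)) (ss k))))) (λ _ → refl) (λ _ → refl)) refl
    (γ-case F Ps′ Qs′ (≡-⊢ (renF-Sum suc Ps) (wkT-⊢ d)) ss-⊢
      (λ l → ≃-⊢ˡ (branch-∀-≃ {Γ = Γ} (Qs l) (reflexive (f l))))))
  (case-≃ F Ps′ (reflexive (≡-⊢ (renF-Sum suc Ps) (wkT-⊢ d))) (λ k → symmetric (≡-≃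
    (cong (_∙ zero) (sym (trans (case-ren² suc id (∀′ F) (ss k) Qs (rs′ k))
      (case-cong {B = renF suc (∀′ F)} refl refl (λ _ → refl) (λ l → ren²-cong (λ _ → refl) (lift*-id (q l)) (rs′ k l))))))
    (case-cong {B = F} refl refl (λ _ → refl) (λ l → cong (_∙ zero) (rs-square k l)))
    (γ-∙ Qs′ zero (renF-inst-suc F) (ss-⊢ k) (rs-⊢ k))))))
  where
  Ps′ : ∀ k → Vec (Form² (suc n)) (p k)
  Ps′ k = map (renF suc) (Ps k)
  Qs′ : ∀ l → Vec (Form² (suc n)) (q l)
  Qs′ l = map (renF suc) (Qs l)
  rs′ : ∀ k l → Term² n (q l ⊕ (p k ⊕ m))
  rs′ k l = ren² id (lift* (q l) (wk* (p k))) (rs l)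
  rs-square : ∀ k l → wkT (rs′ k l) ≡ ren² id (lift* (q l) (wk* (p k))) (wkT (rs l))
  rs-square k l = ren²-square (λ _ → refl) (λ _ → refl) (rs l)
  ss-⊢ : ∀ k → map (renF suc) Γ ◁ Ps′ k ⊢ wkT (ss k) ∶ Sum Qs′
  ss-⊢ k = ≡-⊢ (renF-Sum suc Qs) (≃-⊢ˡ (wkT-◁-≃ {Γ = Γ} (Ps k) (reflexive (e k))))
  rs-⊢ : ∀ k l → (map (renF suc) Γ ◁ Ps′ k) ◁ Qs′ l ⊢ wkT (rs′ k l) ∶ renF suc (∀′ F)
  rs-⊢ k l = subst ((map (renF suc) Γ ◁ Ps′ k) ◁ Qs′ l ⊢_∶ renF suc (∀′ F)) (sym (rs-square k l))
    (≃-⊢ˡ (lift*-≃ {Γ = map (renF suc) Γ} {map (renF suc) Γ ◁ Ps′ k} (Qs′ l)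
      (lookup-◁-wk* (map (renF suc) Γ) (Ps′ k))
      (wkT-◁-≃ {Γ = Γ} (Qs l) (reflexive (f l)))))

-- η for case distinction.

-- Complete η-expansion of a term of sum type.
Sum-η : ∀ {n m K} {p : Fin K → ℕ} {Γ : Ctx² n m} (Ps : ∀ k → Vec (Form² n) (p k)) {t} →
        Γ ⊢ t ∶ Sum Ps →
        Γ ⊢ Λ (ƛ* (Clauses Ps) ((ren² suc (wk* K) t ∙ zero) ·* (λ k → var (bound² {p = K} k)))) ≃ t ∶ Sum Ps
Sum-η {K = K} Ps {t} d = transitive
  (≡-≃ (cong (λ w → Λ (ƛ* (Clauses Ps) ((w ∙ zero) ·* (λ k → var (bound² {p = K} k)))))
         (ren²-∘ (λ _ → refl) (λ _ → refl) t)) refl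
    (Λ-cong (ƛ*-η (Clauses Ps) (≡-⊢ (renF-inst-suc _) (wkT-⊢ d ∙ zero)))))
  (∀η d)

-- †η after elimination of both sides.
case-inj-bound : ∀ {n m K} {p : Fin K → ℕ} {Γ : Ctx² n m} (Ps : ∀ k → Vec (Form² n) (p k)) Y {t}
                 {us : Vector (Term² n m) K} →
                 Γ ⊢ t ∶ Sum Ps → (∀ k → Γ ⊢ us k ∶ Ps k ⊃* var Y) →
                 Γ ⊢ (case (Sum Ps) t Ps (λ k → inj Ps k (λ i → var (bound² i))) ∙ Y) ·* us ≃
                     (t ∙ Y) ·* us ∶ var Y
case-inj-bound {p = p} {Γ} Ps Y {us = us} d e = transitive
  (γ-Sum-elim Ps Ps Y d (λ k → ≃-⊢ˡ (inj-≃ Ps k (λ i → reflexive (bound-⊢ k i)))) e)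
  (Sum-elim-≃ Ps Y (reflexive d) (λ k → transitive
    (ƛ*-≃ (Ps k) (inj-β Ps Y k (bound-⊢ k) (λ l → ≃-⊢ˡ (wk*-≃ (Ps k) (reflexive (e l))))))
    (ƛ*-η (Ps k) (e k))))
  where
  bound-⊢ : ∀ k i → Γ ◁ Ps k ⊢ var (bound² i) ∶ lookup (Ps k) i
  bound-⊢ k i = var-⊢ (lookup-◁-bound² Γ (Ps k) i)

case-η : ∀ {n m K} {p : Fin K → ℕ} {Γ : Ctx² n m} (Ps : ∀ k → Vec (Form² n) (p k)) {t} →
         Γ ⊢ t ∶ Sum Ps →
         Γ ⊢ case (Sum Ps) t Ps (λ k → inj Ps k (λ i → var (bound² i))) ≃ t ∶ Sum Ps
case-η {n} {m} {K} {p} {Γ} Ps {t} d = transitive (symmetric (Sum-η Ps case′-⊢))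
  (transitive (Λ-cong (ƛ*-≃ (Clauses Ps)
      (≡-≃ (cong (λ w → (w ∙ zero) ·* (λ k → var (bound² {p = K} k))) (sym ren²-case′)) refl
        (case-inj-bound Ps′ zero
          (≡-⊢ (renF-Sum suc Ps)
            (ren²-⊢ (λ x → trans (lookup-◁-wk* _ (Clauses Ps) x) (lookup-map x _ Γ)) d))
          (λ k → var-⊢ (trans (lookup-◁-bound² _ (Clauses Ps) k) (lookup∘tabulate _ k)))))))
    (Sum-η Ps d))
  where
  Ps′ : ∀ k → Vec (Form² (suc n)) (p k)
  Ps′ k = map (renF suc) (Ps k)
  case′ : Term² n m
  case′ = case (Sum Ps) t Ps (λ k → inj Ps k (λ i → var (bound² i)))
  case′-⊢ : Γ ⊢ case′ ∶ Sum Ps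
  case′-⊢ = case-⊢ (Sum Ps) Ps d
    (λ k → ≃-⊢ˡ (inj-≃ Ps k (λ i → reflexive (var-⊢ (lookup-◁-bound² Γ (Ps k) i)))))
  ren²-case′ : ren² suc (wk* K) case′ ≡
               case (Sum Ps′) (ren² suc (wk* K) t) Ps′ (λ k → inj Ps′ k (λ i → var (bound² i)))
  ren²-case′ = trans (case-ren² suc (wk* K) (Sum Ps) t Ps _)
    (case-cong (renF-Sum suc Ps) refl (λ _ → refl) (λ k →
      trans (inj-ren² suc (lift* (p k) (wk* K)) Ps k _)
        (inj-cong {Ps = Ps′} k (λ _ → refl) (λ i → cong var (lift*-bound² (wk* K) i)))))

-- The ESF-translation in terms of inj and case.

-- The definition with contexts, which opens all fresh variables of B at once,
-- agrees with the recursive one.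
In-El : ∀ {n m K} {p : Fin K → ℕ} (B : Form² n) t (Ps : ∀ k → Vec (Form² n) (p k))
        (ss : ∀ k → Term² n (p k ⊕ m)) →
        In B ((ren² (tyWk B) (tmWk B) t ∙ at B) ·*
              (λ k → ƛ* (map (renF (tyWk B)) (Ps k)) (El (p k) B (ss k)))) ≡ case B t Ps ss
In-El (var Z) t Ps ss = ·*-cong (cong (_∙ Z) (ren²-id (λ _ → refl) (λ _ → refl) t))
  (λ k → cong (λ As → ƛ* As (ss k)) (map-renF-id (Ps k)))
In-El {K = K} {p} (C ⊃ D) t Ps ss = cong (ƛ C) (trans
  (cong (In D) (·*-cong {p = K} (cong (_∙ at D) (sym (ren²-∘ (λ _ → refl) (λ _ → refl) t))) (λ _ → refl)))
  (In-El D (wk t) Ps (λ k → ren² id (lift* (p k) suc) (ss k) · var (wk* (p k) zero))))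
In-El {K = K} {p} (∀′ D) t Ps ss = cong Λ (trans
  (cong (In D) (·*-cong {p = K} (cong (_∙ at D) (sym (ren²-∘ (λ _ → refl) (λ _ → refl) t)))
    (λ k → cong (λ As → ƛ* As (El (p k) D (wkT (ss k) ∙ zero))) (sym (map-fuse (renF-∘ (λ _ → refl)) (Ps k))))))
  (In-El D (wkT t) (λ k → map (renF suc) (Ps k)) (λ k → wkT (ss k) ∙ zero)))

-- The translated premise types, grouped by the constructor k.
premises⋆ : ∀ {n} (c : Connective) → Vector (Formᵖ n) (I c) → ∀ k → Vec (Form² n) (arity c k)
premises⋆ c A = premises c (λ i → A i ⋆)

map-premises : ∀ {X Y : Set} (c : Connective) (h : X → Y) (A : Vector X (I c)) k →
               map h (premises c A k) ≡ premises c (h ∘ A) k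
map-premises c h A k = sym (map-∘ _ _ (fromList (Connective.fibre c k)))

-- Weakening before or after selecting the premises.
clauses≡Clauses : ∀ {n} c (A : Vector (Form² n) (I c)) → clauses c A ≡ Clauses (premises c A)
clauses≡Clauses c A = tabulate-cong (λ k → cong (_⊃* var zero) (sym (map-premises c (renF suc) A k)))

†-⋆ : ∀ {n} c (A : Vector (Formᵖ n) (I c)) → † c A ⋆ ≡ Sum (premises⋆ c A)
†-⋆ c A = cong (λ Cs → ∀′ (Cs ⊃* var zero)) (clauses≡Clauses c (λ i → A i ⋆))

ι-♯ : ∀ {n m} {Γ : Ctxᵖ n m} {c A} k (ts : ∀ i → Γ ⊢ lookup (premises c A k) i) →
      ι {c = c} {A} k ts ♯ ≡ inj (premises⋆ c A) k (λ i → ts i ♯)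
ι-♯ {c = c} {A} k ts = cong
  (λ Cs → Λ (ƛ* Cs (var (bound² k) ·* (λ i → ren² suc (wk* (K c)) (ts i ♯)))))
  (clauses≡Clauses c (λ i → A i ⋆))

δ-♯ : ∀ {n m} {Γ : Ctxᵖ n m} {c A C} (t : Γ ⊢ † c A) (ss : ∀ k → Γ ◁ premises c A k ⊢ C) →
      δ t ss ♯ ≡ case (C ⋆) (t ♯) (premises⋆ c A) (λ k → ss k ♯)
δ-♯ {c = c} {A} {C} t ss = trans
  (cong (In (C ⋆)) (·*-cong refl (λ k → cong (λ As → ƛ* As (El (arity c k) (C ⋆) (ss k ♯)))
    (sym (map-premises c (renF (tyWk (C ⋆))) (λ i → A i ⋆) k)))))
  (In-El (C ⋆) (t ♯) (premises⋆ c A) (λ k → ss k ♯))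

-- The translation commutes with renaming and substitution.

liftRᵖ-index : ∀ {n m m′} {Γ : Ctxᵖ n m} {Δ : Ctxᵖ n m′} {B} {ρ : Renᵖ Γ Δ} {ξ} →
                (∀ {A} (x : A ∈ Γ) → index (ρ x) ≡ ξ (index x)) →
                ∀ {A} (x : A ∈ B ∷ Γ) → index (liftRᵖ {Γ = Γ} {Δ} ρ x) ≡ lift 1 ξ (index x)
liftRᵖ-index e (here _)  = refl
liftRᵖ-index e (there x) = cong suc (e x)

liftRᵖ*-index : ∀ {n m m′ p} {Γ : Ctxᵖ n m} {Δ : Ctxᵖ n m′} (Bs : Vec (Formᵖ n) p) {ρ : Renᵖ Γ Δ} {ξ} →
                (∀ {A} (x : A ∈ Γ) → index (ρ x) ≡ ξ (index x)) →
                ∀ {A} (x : A ∈ Γ ◁ Bs) → index (liftRᵖ* {Γ = Γ} {Δ} Bs ρ x) ≡ lift* p ξ (index x)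
liftRᵖ*-index []       e = e
liftRᵖ*-index {Γ = Γ} {Δ} (B ∷ Bs) {ρ} e =
  liftRᵖ*-index {Γ = B ∷ Γ} {B ∷ Δ} Bs (liftRᵖ-index {Γ = Γ} {Δ} {ρ = ρ} e)

♯-ren : ∀ {n m m′} {Γ : Ctxᵖ n m} {Δ : Ctxᵖ n m′} {ρ : Renᵖ Γ Δ} {ξ} →
        (∀ {A} (x : A ∈ Γ) → index (ρ x) ≡ ξ (index x)) →
        ∀ {A} (t : Γ ⊢ A) → renᵖ ρ t ♯ ≡ ren² id ξ (t ♯)
♯-ren e (var x) = cong var (e x)
♯-ren {Γ = Γ} {Δ} {ρ} e (ƛ t) = cong₂ ƛ (sym (renF-id (λ _ → refl) _))
  (♯-ren (liftRᵖ-index {Γ = Γ} {Δ} {ρ = ρ} e) t)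
♯-ren e (t · u) = cong₂ _·_ (♯-ren e t) (♯-ren e u)
♯-ren {ρ = ρ} {ξ} e (ι {c} {A} k ts) = begin
  ι {c = c} {A} k (λ i → renᵖ ρ (ts i)) ♯
    ≡⟨ ι-♯ {c = c} {A} k (λ i → renᵖ ρ (ts i)) ⟩
  inj P k (λ i → renᵖ ρ (ts i) ♯)
    ≡⟨ inj-cong {Qs = λ k → map (renF id) (P k)} k (λ k → sym (map-renF-id (P k)))
         (λ i → ♯-ren e (ts i)) ⟩
  inj (λ k → map (renF id) (P k)) k (λ i → ren² id ξ (ts i ♯)) ≡⟨ inj-ren² id ξ P k (λ i → ts i ♯) ⟨
  ren² id ξ (inj P k (λ i → ts i ♯))                    ≡⟨ cong (ren² id ξ) (ι-♯ {c = c} {A} k ts) ⟨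
  ren² id ξ (ι {c = c} {A} k ts ♯)                      ∎
  where
  open ≡-Reasoning
  P = premises⋆ c A
♯-ren {Γ = Γ} {Δ} {ρ} {ξ} e (δ {c} {A} {C} t ss) = begin
  renᵖ ρ (δ t ss) ♯
    ≡⟨ δ-♯ (renᵖ ρ t) (λ k → renᵖ (liftRᵖ* (premises c A k) ρ) (ss k)) ⟩
  case (C ⋆) (renᵖ ρ t ♯) P (λ k → renᵖ (liftRᵖ* (premises c A k) ρ) (ss k) ♯)
    ≡⟨ case-cong {B = C ⋆} refl (♯-ren e t) (λ _ → refl)
         (λ k → ♯-ren (liftRᵖ*-index {Γ = Γ} {Δ} (premises c A k) {ρ} e) (ss k)) ⟩
  case (C ⋆) (ren² id ξ (t ♯)) P (λ k → ren² id (lift* (arity c k) ξ) (ss k ♯))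
    ≡⟨ case-ren²-id ξ (C ⋆) (t ♯) P (λ k → ss k ♯) ⟨
  ren² id ξ (case (C ⋆) (t ♯) P (λ k → ss k ♯))         ≡⟨ cong (ren² id ξ) (δ-♯ t ss) ⟨
  ren² id ξ (δ t ss ♯)                                  ∎
  where
  open ≡-Reasoning
  P = premises⋆ c A

liftSᵖ-♯ : ∀ {n m m′} {Γ : Ctxᵖ n m} {Δ : Ctxᵖ n m′} {B} {σ : Subᵖ Γ Δ} {τ} →
           (∀ {A} (x : A ∈ Γ) → σ x ♯ ≡ τ (index x)) →
           ∀ {A} (x : A ∈ B ∷ Γ) → liftSᵖ {Γ = Γ} {Δ} σ x ♯ ≡ liftS² τ (index x)
liftSᵖ-♯ e (here _)  = refl
liftSᵖ-♯ {σ = σ} e (there x) = trans (♯-ren (λ _ → refl) (σ x)) (cong wk (e x))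

liftSᵖ*-♯ : ∀ {n m m′ p} {Γ : Ctxᵖ n m} {Δ : Ctxᵖ n m′} (Bs : Vec (Formᵖ n) p) {σ : Subᵖ Γ Δ} {τ} →
            (∀ {A} (x : A ∈ Γ) → σ x ♯ ≡ τ (index x)) →
            ∀ {A} (x : A ∈ Γ ◁ Bs) → liftSᵖ* {Γ = Γ} {Δ} Bs σ x ♯ ≡ liftS* p τ (index x)
liftSᵖ*-♯ []       e = e
liftSᵖ*-♯ {Γ = Γ} {Δ} (B ∷ Bs) {σ} e =
  liftSᵖ*-♯ {Γ = B ∷ Γ} {B ∷ Δ} Bs (liftSᵖ-♯ {Γ = Γ} {Δ} {σ = σ} e)

♯-sub : ∀ {n m m′} {Γ : Ctxᵖ n m} {Δ : Ctxᵖ n m′} {σ : Subᵖ Γ Δ} {τ} →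
        (∀ {A} (x : A ∈ Γ) → σ x ♯ ≡ τ (index x)) →
        ∀ {A} (t : Γ ⊢ A) → subᵖ σ t ♯ ≡ sub² τ (t ♯)
♯-sub e (var x) = e x
♯-sub {Γ = Γ} {Δ} {σ} e (ƛ t) = cong (ƛ _) (♯-sub (liftSᵖ-♯ {Γ = Γ} {Δ} {σ = σ} e) t)
♯-sub e (t · u) = cong₂ _·_ (♯-sub e t) (♯-sub e u)
♯-sub {σ = σ} {τ} e (ι {c} {A} k ts) = begin
  ι {c = c} {A} k (λ i → subᵖ σ (ts i)) ♯
    ≡⟨ ι-♯ {c = c} {A} k (λ i → subᵖ σ (ts i)) ⟩
  inj P k (λ i → subᵖ σ (ts i) ♯)
    ≡⟨ inj-cong {Ps = P} {λ k → map (renF id) (P k)} k (λ k → sym (map-renF-id (P k)))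
         (λ i → trans (♯-sub e (ts i)) (sub²≗msub (λ _ → refl) (ts i ♯))) ⟩
  inj (λ k → map (renF id) (P k)) k (λ i → msub id τ (ts i ♯)) ≡⟨ inj-msub id τ P k (λ i → ts i ♯) ⟨
  msub id τ (inj P k (λ i → ts i ♯))
    ≡⟨ sub²≗msub (λ _ → refl) (inj P k (λ i → ts i ♯)) ⟨
  sub² τ (inj P k (λ i → ts i ♯))                       ≡⟨ cong (sub² τ) (ι-♯ {c = c} {A} k ts) ⟨
  sub² τ (ι {c = c} {A} k ts ♯)                         ∎
  where
  open ≡-Reasoning
  P = premises⋆ c A
♯-sub {Γ = Γ} {Δ} {σ} {τ} e (δ {c} {A} {C} t ss) = begin
  subᵖ σ (δ t ss) ♯
    ≡⟨ δ-♯ (subᵖ σ t) (λ k → subᵖ (liftSᵖ* (premises c A k) σ) (ss k)) ⟩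
  case (C ⋆) (subᵖ σ t ♯) P (λ k → subᵖ (liftSᵖ* (premises c A k) σ) (ss k) ♯)
    ≡⟨ case-cong {B = C ⋆} refl (♯-sub e t) (λ _ → refl)
         (λ k → ♯-sub (liftSᵖ*-♯ {Γ = Γ} {Δ} (premises c A k) {σ} e) (ss k)) ⟩
  case (C ⋆) (sub² τ (t ♯)) P (λ k → sub² (liftS* (arity c k) τ) (ss k ♯))
    ≡⟨ case-sub² τ (C ⋆) (t ♯) P (λ k → ss k ♯) ⟨
  sub² τ (case (C ⋆) (t ♯) P (λ k → ss k ♯))            ≡⟨ cong (sub² τ) (δ-♯ t ss) ⟨
  sub² τ (δ t ss ♯)                                     ∎
  where
  open ≡-Reasoning
  P = premises⋆ c A

♯-⟦⟧ : ∀ {n m} {Γ : Ctxᵖ n m} {A B} (t : A ∷ Γ ⊢ B) (s : Γ ⊢ A) → (t ⟦ s ⟧ᵖ) ♯ ≡ (t ♯) ⟦ s ♯ ⟧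
♯-⟦⟧ t s = ♯-sub (λ { (here refl) → refl ; (there x) → refl }) t

consSᵖ*-♯ : ∀ {n m m′ p} {Γ : Ctxᵖ n m} {Δ : Ctxᵖ n m′} (Bs : Vec (Formᵖ n) p) {σ : Subᵖ Γ Δ} {τ}
            (ts : ∀ i → Δ ⊢ lookup Bs i) →
            (∀ {A} (x : A ∈ Γ) → σ x ♯ ≡ τ (index x)) →
            ∀ {A} (x : A ∈ Γ ◁ Bs) → consSᵖ* {Γ = Γ} {Δ} Bs σ ts x ♯ ≡ consS* τ (λ i → ts i ♯) (index x)
consSᵖ*-♯ []       ts e = e
consSᵖ*-♯ {Γ = Γ} {Δ} (B ∷ Bs) ts e = consSᵖ*-♯ {Γ = B ∷ Γ} {Δ} Bs (ts ∘ suc)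
  λ { (here refl) → refl ; (there x) → e x }

♯-subst* : ∀ {n m p} {Γ : Ctxᵖ n m} {A} (Bs : Vec (Formᵖ n) p) (t : Γ ◁ Bs ⊢ A) ts →
           subst* Bs t ts ♯ ≡ sub² (consS* var (λ i → ts i ♯)) (t ♯)
♯-subst* {Γ = Γ} Bs t ts = ♯-sub (consSᵖ*-♯ {Γ = Γ} {Γ} Bs {var} ts (λ _ → refl)) t

wkᵖ*-index : ∀ {n m p} {Γ : Ctxᵖ n m} (Bs : Vec (Formᵖ n) p) {A} (x : A ∈ Γ) →
             index (wkᵖ* Bs x) ≡ wk* p (index x)
wkᵖ*-index []       x = refl
wkᵖ*-index (B ∷ Bs) x = wkᵖ*-index Bs (there x)

bound-index : ∀ {n m p} {Γ : Ctxᵖ n m} (Bs : Vec (Formᵖ n) p) i →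
              index (bound {Γ = Γ} Bs i) ≡ bound² i
bound-index {Γ = Γ} (B ∷ Bs) zero    = wkᵖ*-index {Γ = B ∷ Γ} Bs (here refl)
bound-index (B ∷ Bs) (suc i) = bound-index Bs i

-- The translation preserves typing and conversion.

-- Translating an extended context is extending the translated context.
branch-≃ : ∀ {n m} {Γ : Ctxᵖ n m} {c} {A : Vector (Formᵖ n) (I c)} {k s r C} →
           map _⋆ (Γ ◁ premises c A k) ⊢ s ≃ r ∶ C → map _⋆ Γ ◁ premises⋆ c A k ⊢ s ≃ r ∶ C
branch-≃ {Γ = Γ} {c} {A} {k} = subst (_⊢ _ ≃ _ ∶ _)
  (trans (map-◁ _⋆ Γ (premises c A k)) (cong (map _⋆ Γ ◁_) (map-premises c _⋆ A k)))

lookup-premises⋆ : ∀ {n c} (A : Vector (Formᵖ n) (I c)) k i →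
                   lookup (premises c A k) i ⋆ ≡ lookup (premises⋆ c A k) i
lookup-premises⋆ {c = c} A k i = trans (sym (lookup-map i _⋆ (premises c A k)))
  (cong (λ As → lookup As i) (map-premises c _⋆ A k))

ι-♯-≃ : ∀ {n m} {Γ : Ctxᵖ n m} {c A} k {ts us : ∀ i → Γ ⊢ lookup (premises c A k) i} →
        (∀ i → map _⋆ Γ ⊢ ts i ♯ ≃ us i ♯ ∶ lookup (premises c A k) i ⋆) →
        map _⋆ Γ ⊢ ι {c = c} {A} k ts ♯ ≃ ι {c = c} {A} k us ♯ ∶ † c A ⋆
ι-♯-≃ {c = c} {A} k {ts} {us} e = ≡-≃-type (sym (†-⋆ c A))
  (≡-≃ (sym (ι-♯ {c = c} {A} k ts)) (sym (ι-♯ {c = c} {A} k us))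
    (inj-≃ (premises⋆ c A) k (λ i → ≡-≃-type (lookup-premises⋆ {c = c} A k i) (e i))))

δ-♯-≃ : ∀ {n m} {Γ : Ctxᵖ n m} {c A C} {t u : Γ ⊢ † c A} {ss rs : ∀ k → Γ ◁ premises c A k ⊢ C} →
        map _⋆ Γ ⊢ t ♯ ≃ u ♯ ∶ † c A ⋆ →
        (∀ k → map _⋆ (Γ ◁ premises c A k) ⊢ ss k ♯ ≃ rs k ♯ ∶ C ⋆) →
        map _⋆ Γ ⊢ δ t ss ♯ ≃ δ u rs ♯ ∶ C ⋆
δ-♯-≃ {Γ = Γ} {c} {A} {C} {t} {u} {ss} {rs} d e = ≡-≃ (sym (δ-♯ t ss)) (sym (δ-♯ u rs))
  (case-≃ (C ⋆) (premises⋆ c A) (≡-≃-type (†-⋆ c A) d) (λ k → branch-≃ {Γ = Γ} {c} {A} (e k)))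

lookup-index⋆ : ∀ {n m} {Γ : Ctxᵖ n m} {A} (x : A ∈ Γ) → lookup (map _⋆ Γ) (index x) ≡ A ⋆
lookup-index⋆ {Γ = _ ∷ _} (here refl) = refl
lookup-index⋆ {Γ = _ ∷ _} (there x)   = lookup-index⋆ x

♯-⊢ : ∀ {n m} {Γ : Ctxᵖ n m} {A} (t : Γ ⊢ A) → map _⋆ Γ ⊢ t ♯ ∶ A ⋆
♯-⊢ (var x) = var-⊢ (lookup-index⋆ x)
♯-⊢ (ƛ t)   = ƛ (♯-⊢ t)
♯-⊢ (t · u) = ♯-⊢ t · ♯-⊢ u
♯-⊢ (ι {c} {A} k ts) = ≃-⊢ˡ (ι-♯-≃ {c = c} {A} k {ts} {ts} (λ i → reflexive (♯-⊢ (ts i))))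
♯-⊢ (δ t ss) = ≃-⊢ˡ (δ-♯-≃ {t = t} {t} {ss} {ss} (reflexive (♯-⊢ t)) (λ k → reflexive (♯-⊢ (ss k))))

scrutinee-⊢ : ∀ {n m} {Γ : Ctxᵖ n m} {c A} (t : Γ ⊢ † c A) → map _⋆ Γ ⊢ t ♯ ∶ Sum (premises⋆ c A)
scrutinee-⊢ {c = c} {A} t = ≡-⊢ (†-⋆ c A) (♯-⊢ t)

branch-⊢ : ∀ {n m} {Γ : Ctxᵖ n m} {c A C k} (s : Γ ◁ premises c A k ⊢ C) →
           map _⋆ Γ ◁ premises⋆ c A k ⊢ s ♯ ∶ C ⋆
branch-⊢ {Γ = Γ} {c} {A} s = ≃-⊢ˡ (branch-≃ {Γ = Γ} {c} {A} (reflexive (♯-⊢ s)))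

†β-♯ : ∀ {n m} {Γ : Ctxᵖ n m} {c A C} h (ts : ∀ i → Γ ⊢ lookup (premises c A h) i)
       (ss : ∀ k → Γ ◁ premises c A k ⊢ C) →
       map _⋆ Γ ⊢ δ (ι {c = c} {A} h ts) ss ♯ ≃ subst* (premises c A h) (ss h) ts ♯ ∶ C ⋆
†β-♯ {c = c} {A} {C} h ts ss = ≡-≃
  (sym (trans (δ-♯ (ι {c = c} {A} h ts) ss)
    (case-cong {B = C ⋆} refl (ι-♯ {c = c} {A} h ts) (λ _ → refl) (λ _ → refl))))
  (sym (♯-subst* (premises c A h) (ss h) ts))
  (case-β (C ⋆) (premises⋆ c A) h
    (λ i → ≡-⊢ (lookup-premises⋆ {c = c} A h i) (♯-⊢ (ts i))) (λ k → branch-⊢ {c = c} {A} (ss k)))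

†η-♯ : ∀ {n m} {Γ : Ctxᵖ n m} {c A} (t : Γ ⊢ † c A) →
       map _⋆ Γ ⊢ δ t (λ k → ι {c = c} {A} k (λ i → var (bound (premises c A k) i))) ♯ ≃ t ♯ ∶ † c A ⋆
†η-♯ {c = c} {A} t = ≡-≃-type (sym (†-⋆ c A)) (≡-≃
  (sym (trans (δ-♯ t (λ k → ι {c = c} {A} k (vars k)))
    (case-cong (†-⋆ c A) refl (λ _ → refl) (λ k → trans (ι-♯ {c = c} {A} k (vars k))
      (inj-cong {Ps = premises⋆ c A} k (λ _ → refl) (λ i → cong var (bound-index (premises c A k) i)))))))
  refl
  (case-η (premises⋆ c A) (scrutinee-⊢ t)))
  where
  vars : ∀ k i → _ ◁ premises c A k ⊢ lookup (premises c A k) i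
  vars k i = var (bound (premises c A k) i)

γ-·-♯ : ∀ {n m} {Γ : Ctxᵖ n m} {c A B C} (t : Γ ⊢ † c A) (ss : ∀ k → Γ ◁ premises c A k ⊢ B ⊃ C) u →
        map _⋆ Γ ⊢ (δ t ss · u) ♯ ≃
                   δ t (λ k → ss k · renᵖ (wkᵖ* (premises c A k)) u) ♯ ∶ C ⋆
γ-·-♯ {Γ = Γ} {c} {A} {B} {C} t ss u = ≡-≃ (cong (_· (u ♯)) (sym (δ-♯ t ss)))
  (sym (trans (δ-♯ t (λ k → ss k · renᵖ (wkᵖ* (premises c A k)) u))
    (case-cong {B = C ⋆} refl refl (λ _ → refl)
      (λ k → cong ((ss k ♯) ·_) (♯-ren (wkᵖ*-index (premises c A k)) u)))))
  (γ-· (premises⋆ c A) (scrutinee-⊢ t) (λ k → branch-⊢ {c = c} {A} (ss k)) (♯-⊢ u))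

γ-δ-♯ : ∀ {n m} {Γ : Ctxᵖ n m} {c c′ A A′ C} (t : Γ ⊢ † c A) (ss : ∀ k → Γ ◁ premises c A k ⊢ † c′ A′)
        (rs : ∀ l → Γ ◁ premises c′ A′ l ⊢ C) →
        map _⋆ Γ ⊢ δ (δ t ss) rs ♯ ≃
                   δ t (λ k → δ (ss k) (λ l →
                     renᵖ (liftRᵖ* (premises c′ A′ l) (wkᵖ* (premises c A k))) (rs l))) ♯ ∶ C ⋆
γ-δ-♯ {Γ = Γ} {c} {c′} {A} {A′} {C} t ss rs = ≡-≃
  (sym (trans (δ-♯ (δ t ss) rs) (case-cong {B = C ⋆} refl
    (trans (δ-♯ t ss) (case-cong (†-⋆ c′ A′) refl (λ _ → refl) (λ _ → refl))) (λ _ → refl) (λ _ → refl))))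
  (sym (trans (δ-♯ t (λ k → δ (ss k) (rs′ k)))
    (case-cong {B = C ⋆} refl refl (λ _ → refl) (λ k → trans (δ-♯ (ss k) (rs′ k))
      (case-cong {B = C ⋆} refl refl (λ _ → refl) (λ l →
        ♯-ren (liftRᵖ*-index {Γ = Γ} {Γ ◁ premises c A k} (premises c′ A′ l) (wkᵖ*-index (premises c A k))) (rs l)))))))
  (γ-case (C ⋆) (premises⋆ c A) (premises⋆ c′ A′) (scrutinee-⊢ t)
    (λ k → ≡-⊢ (†-⋆ c′ A′) (branch-⊢ {c = c} {A} (ss k))) (λ l → branch-⊢ {c = c′} {A′} (rs l)))
  where
  rs′ : ∀ k l → (Γ ◁ premises c A k) ◁ premises c′ A′ l ⊢ C
  rs′ k l = renᵖ (liftRᵖ* (premises c′ A′ l) (wkᵖ* (premises c A k))) (rs l)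

-- One frame of the elimination context at a time, from the inside out.
†γ-♯ : ∀ {n m} {Γ : Ctxᵖ n m} {c A C D} (E : ECtx Γ C D) (t : Γ ⊢ † c A)
       (ss : ∀ k → Γ ◁ premises c A k ⊢ C) →
       map _⋆ Γ ⊢ E [ δ t ss ]ᴱ ♯ ≃
                  δ t (λ k → renᴱ (wkᵖ* (premises c A k)) E [ ss k ]ᴱ) ♯ ∶ D ⋆
†γ-♯ [] t ss = reflexive (♯-⊢ (δ t ss))
†γ-♯ {c = c} {A} (E · u) t ss = transitive
  (·-cong (†γ-♯ E t ss) (reflexive (♯-⊢ u)))
  (γ-·-♯ t (λ k → renᴱ (wkᵖ* (premises c A k)) E [ ss k ]ᴱ) u)
†γ-♯ {c = c} {A} (δ E rs) t ss = transitive
  (δ-♯-≃ {t = E [ δ t ss ]ᴱ} {δ t ss′} {rs} {rs} (†γ-♯ E t ss) (λ l → reflexive (♯-⊢ (rs l))))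
  (γ-δ-♯ t ss′ rs)
  where
  ss′ : ∀ k → _ ◁ premises c A k ⊢ _
  ss′ k = renᴱ (wkᵖ* (premises c A k)) E [ ss k ]ᴱ

♯-≃ : ∀ {n m} {Γ : Ctxᵖ n m} {A} {u v : Γ ⊢ A} → u ⇝ v → map _⋆ Γ ⊢ u ♯ ≃ v ♯ ∶ A ⋆
♯-≃ (reflexive {t = t})  = reflexive (♯-⊢ t)
♯-≃ (transitive r s)     = transitive (♯-≃ r) (♯-≃ s)
♯-≃ (ƛ-cong r)           = ƛ-cong (♯-≃ r)
♯-≃ (·-cong r s)         = ·-cong (♯-≃ r) (♯-≃ s)
♯-≃ (ι-cong {c} {A} {k} {ts} {ts′} rs) = ι-♯-≃ {c = c} {A} k {ts} {ts′} (λ i → ♯-≃ (rs i))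
♯-≃ (δ-cong {t = t} {t′} {ss} {ss′} r rs) = δ-♯-≃ {t = t} {t′} {ss} {ss′} (♯-≃ r) (λ k → ♯-≃ (rs k))
♯-≃ (⊃β t s)             = ≡-≃ refl (sym (♯-⟦⟧ t s)) (⊃β (♯-⊢ t) (♯-⊢ s))
♯-≃ (†β {c} {A} h ts ss) = †β-♯ {c = c} {A} h ts ss
♯-≃ (⊃η {A} t)           =
  ≡-≃ (cong (λ w → ƛ (A ⋆) (w · var zero)) (sym (♯-ren (λ _ → refl) t))) refl (⊃η (♯-⊢ t))
♯-≃ (†η t)               = †η-♯ t
♯-≃ (†γ E t ss)          = †γ-♯ E t ss

proposition12 : ∀ {n m : ℕ} (Γ : Ctxᵖ n m) (A : Formᵖ n) (u v : Γ ⊢ A) → u ⇝ v → map _⋆ Γ ⊢ u ♯ ≃ v ♯ ∶ A ⋆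
proposition12 Γ A u v = ♯-≃
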